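{- For $n\ge 2$, define the homogeneous polynomial $$H_n(t,x_1,\dots,x_n)=(x_1-t)^4+(x_1-2x_2)^4+\sum_{i=2}^{n-1}(x_i^2-t\,x_{i+1})^2+4(x_1-t)^2x_n^2+2x_n^4 .$$ Then the subtraction-free complexity of $H_n$ is finite and is greater than $2^{n-2}$. By contrast, the ordinary arithmetic circuit complexity of $H_n$ is linear in $n$ (that is, $O(n)$).
   Context: An arithmetic circuit is a directed acyclic network whose gates each perform one binary arithmetic operation (addition, subtraction, multiplication or division); its inputs are the variables and arbitrary positive integer scalars, and it outputs a rational function in the variables. The size of a circuit is its number of gates. The ordinary arithmetic circuit complexity of a rational function is the smallest size of an arithmetic circuit computing it. The subtraction-free complexity of a rational function is the smallest size of a circuit computing it that uses only addition, multiplication and division gates; it is finite exactly when such a circuit exists. -}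

module Defs where

open import Algebra.Bundles using (RawRing)
import Algebra.Definitions.RawSemiring as RawSemiringDefinitions
open import Data.Fin.Base using (Fin; zero; suc; inject₁; fromℕ)
open import Data.Integer.Base as ℤ using (ℤ; 0ℤ; 1ℤ)
import Data.Integer.Properties as ℤ
open import Data.Nat.Base as ℕ using (ℕ; zero; suc; s≤s)
open import Data.Product.Base using (_×_; _,_; Σ-syntax)
open import Data.Sum.Base as Sum using (_⊎_; inj₁; inj₂; [_,_]′)
open import Data.Unit.Base using (⊤)
open import Data.Empty using (⊥-elim)
open import Data.Vec.Base using (Vec; []; _∷_; lookup; replicate)
open import Level using (0ℓ)
open import Relation.Binary.PropositionalEquality
  using (_≡_; refl; sym; trans; cong)
open import Relation.Nullary using (¬_; Dec; yes; no)

------------------------------------------------------------------------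
-- Polynomials

-- Poly n is ℤ[y₀,…,yₙ₋₁], represented as ℤ[y₁,…,yₙ₋₁][y₀]: the element
-- a₀ ∷ a₁ ∷ … ∷ [] of Poly (suc n) is a₀ + a₁ y₀ + a₂ y₀² + ….
-- Trailing zero coefficients are allowed, so equality of polynomials is
-- _≈_ below, not _≡_.

infixr 5 _∷_

data Poly : ℕ → Set where
  int : ℤ → Poly 0
  []  : ∀ {n} → Poly (suc n)
  _∷_ : ∀ {n} → Poly n → Poly (suc n) → Poly (suc n)

coeff : ∀ {n} → Poly n → Vec ℕ n → ℤ
coeff (int a) []            = a
coeff []      (_ ∷ _)       = 0ℤ
coeff (a ∷ p) (zero  ∷ e)   = coeff a e
coeff (a ∷ p) (suc k ∷ e)   = coeff p (k ∷ e)

con : ∀ {n} → ℤ → Poly n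
con {zero}  c = int c
con {suc n} c = con c ∷ []

0# : ∀ {n} → Poly n
0# {zero}  = int 0ℤ
0# {suc n} = []

1# : ∀ {n} → Poly n
1# = con 1ℤ

var : ∀ {n} → Fin n → Poly n
var zero    = 0# ∷ 1# ∷ []
var (suc i) = var i ∷ []

infix  8 -_
infixl 7 _*_ _·_
infixl 6 _+_ _-_
infix  4 _≈_ _≉_

_+_ : ∀ {n} → Poly n → Poly n → Poly n
int a   + int b   = int (a ℤ.+ b)
[]      + q       = q
(a ∷ p) + []      = a ∷ p
(a ∷ p) + (b ∷ q) = (a + b) ∷ (p + q)

-_ : ∀ {n} → Poly n → Poly n
- int a   = int (ℤ.- a)
- []      = []
- (a ∷ p) = (- a) ∷ (- p)

_-_ : ∀ {n} → Poly n → Poly n → Poly n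
p - q = p + (- q)

_*_ : ∀ {n} → Poly n → Poly n → Poly n
_·_ : ∀ {n} → Poly n → Poly (suc n) → Poly (suc n)

int a   * int b = int (a ℤ.* b)
[]      * q     = []
(a ∷ p) * q     = a · q + (0# ∷ p * q)

a · []      = []
a · (b ∷ q) = a * b ∷ a · q

record _≈_ {n} (p q : Poly n) : Set where
  constructor mk≈
  field coeff≡ : ∀ e → coeff p e ≡ coeff q e

open _≈_ public

_≉_ : ∀ {n} → Poly n → Poly n → Set
p ≉ q = ¬ (p ≈ q)

polyRawRing : ℕ → RawRing 0ℓ 0ℓ
polyRawRing n = record
  { Carrier = Poly n
  ; _≈_     = _≈_
  ; _+_     = _+_
  ; _*_     = _*_
  ; -_      = -_
  ; 0#      = 0#
  ; 1#      = 1#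
  }

------------------------------------------------------------------------
-- ℤ[y₀,…,yₙ₋₁] is an integral domain

Zero : ∀ {n} → Poly n → Set
Zero p = ∀ e → coeff p e ≡ 0ℤ

coeff-0# : ∀ {n} → Zero (0# {n})
coeff-0# {zero}  []      = refl
coeff-0# {suc n} (_ ∷ _) = refl

coeff-con : ∀ {n} c → coeff (con {n} c) (replicate n 0) ≡ c
coeff-con {zero}  c = refl
coeff-con {suc n} c = coeff-con {n} c

coeff-+ : ∀ {n} (p q : Poly n) e → coeff (p + q) e ≡ coeff p e ℤ.+ coeff q e
coeff-+ (int a) (int b) []          = refl
coeff-+ []      q       (k ∷ e)     = sym (ℤ.+-identityˡ _)
coeff-+ (a ∷ p) []      (k ∷ e)     = sym (ℤ.+-identityʳ _)
coeff-+ (a ∷ p) (b ∷ q) (zero ∷ e)  = coeff-+ a b e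
coeff-+ (a ∷ p) (b ∷ q) (suc k ∷ e) = coeff-+ p q (k ∷ e)

-- Cancelling a summand that vanishes at the exponent in question.
dropˡ : ∀ {n} (p q : Poly n) e → coeff p e ≡ 0ℤ → coeff (p + q) e ≡ coeff q e
dropˡ p q e z = trans (coeff-+ p q e)
  (trans (cong (ℤ._+ coeff q e) z) (ℤ.+-identityˡ _))

dropʳ : ∀ {n} (p q : Poly n) e → coeff q e ≡ 0ℤ → coeff (p + q) e ≡ coeff p e
dropʳ p q e z = trans (coeff-+ p q e)
  (trans (cong (ℤ._+_ (coeff p e)) z) (ℤ.+-identityʳ _))

zero? : ∀ {n} (p : Poly n) → Dec (Zero p)
zero? (int a) with a ℤ.≟ 0ℤ
... | yes a≡0 = yes λ { [] → a≡0 }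
... | no  a≢0 = no λ z → a≢0 (z [])
zero? [] = yes coeff-0#
zero? (a ∷ p) with zero? a | zero? p
... | yes za | yes zp = yes λ { (zero ∷ e) → za e ; (suc k ∷ e) → zp (k ∷ e) }
... | no ¬za | _      = no λ z → ¬za λ e → z (zero ∷ e)
... | yes _  | no ¬zp = no λ z → ¬zp λ { (k ∷ e) → z (suc k ∷ e) }

*-zeroˡ : ∀ {n} (p q : Poly n) → Zero p → Zero (p * q)
·-zeroˡ : ∀ {n} (a : Poly n) q → Zero a → Zero (a · q)

*-zeroˡ (int a) (int b) z []      = cong (ℤ._* b) (z [])
*-zeroˡ []      q       z e       = coeff-0# e
*-zeroˡ (a ∷ p) q       z (k ∷ e) =
  trans (dropˡ (a · q) (0# ∷ p * q) (k ∷ e)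
               (·-zeroˡ a q (λ e → z (zero ∷ e)) (k ∷ e)))
        (shifted k)
  where
  shifted : ∀ k → coeff (0# ∷ p * q) (k ∷ e) ≡ 0ℤ
  shifted zero    = coeff-0# e
  shifted (suc k) = *-zeroˡ p q (λ { (k ∷ e) → z (suc k ∷ e) }) (k ∷ e)

·-zeroˡ a []      z e           = coeff-0# e
·-zeroˡ a (b ∷ q) z (zero ∷ e)  = *-zeroˡ a b z e
·-zeroˡ a (b ∷ q) z (suc k ∷ e) = ·-zeroˡ a q z (k ∷ e)

*-zeroʳ : ∀ {n} (p q : Poly n) → Zero q → Zero (p * q)
·-zeroʳ : ∀ {n} (a : Poly n) q → Zero q → Zero (a · q)

*-zeroʳ (int a) (int b) z []      = trans (cong (a ℤ.*_) (z [])) (ℤ.*-zeroʳ a)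
*-zeroʳ []      q       z e       = coeff-0# e
*-zeroʳ (a ∷ p) q       z (k ∷ e) =
  trans (dropˡ (a · q) (0# ∷ p * q) (k ∷ e) (·-zeroʳ a q z (k ∷ e))) (shifted k)
  where
  shifted : ∀ k → coeff (0# ∷ p * q) (k ∷ e) ≡ 0ℤ
  shifted zero    = coeff-0# e
  shifted (suc k) = *-zeroʳ p q z (k ∷ e)

·-zeroʳ a []      z e           = coeff-0# e
·-zeroʳ a (b ∷ q) z (zero ∷ e)  = *-zeroʳ a b (λ e → z (zero ∷ e)) e
·-zeroʳ a (b ∷ q) z (suc k ∷ e) =
  ·-zeroʳ a q (λ { (k ∷ e) → z (suc k ∷ e) }) (k ∷ e)

-- If b = 0 then b + q y₀ = q y₀.
*-shiftʳ : ∀ {n} (p : Poly (suc n)) b q → Zero b →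
           ∀ k e → coeff (p * (b ∷ q)) (suc k ∷ e) ≡ coeff (p * q) (k ∷ e)
*-shiftʳ []      b q z k e = refl
*-shiftʳ (a ∷ p) b q z k e = trans
  (coeff-+ (a · q) (p * (b ∷ q)) (k ∷ e))
  (trans (cong (ℤ._+_ (coeff (a · q) (k ∷ e))) (tail k))
         (sym (coeff-+ (a · q) (0# ∷ p * q) (k ∷ e))))
  where
  constant : ∀ p → coeff (p * (b ∷ q)) (zero ∷ e) ≡ 0ℤ
  constant []      = refl
  constant (a ∷ p) = trans (dropʳ (a * b) 0# e (coeff-0# e)) (*-zeroʳ a b z e)

  tail : ∀ k → coeff (p * (b ∷ q)) (k ∷ e) ≡ coeff (0# ∷ p * q) (k ∷ e)
  tail zero    = trans (constant p) (sym (coeff-0# e))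
  tail (suc k) = *-shiftʳ p b q z k e

by-cases : {A B C : Set} → Dec A → Dec B →
           (A → C) → (B → C) → (¬ A → ¬ B → C) → C
by-cases (yes a) _       f g h = f a
by-cases (no _)  (yes b) f g h = g b
by-cases (no ¬a) (no ¬b) f g h = h ¬a ¬b

zero-product : ∀ {n} (p q : Poly n) → Zero (p * q) → Zero p ⊎ Zero q
zero-product (int a) (int b) z with ℤ.i*j≡0⇒i≡0∨j≡0 a (z [])
... | inj₁ a≡0 = inj₁ λ { [] → a≡0 }
... | inj₂ b≡0 = inj₂ λ { [] → b≡0 }
zero-product []      q       z = inj₁ coeff-0#
zero-product (a ∷ p) []      z = inj₂ coeff-0#
zero-product (a ∷ p) (b ∷ q) z = by-cases (zero? a) (zero? b)
  (λ za → Sum.map₁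
    (λ { zp (zero ∷ e) → za e ; zp (suc k ∷ e) → zp (k ∷ e) })
    (zero-product p (b ∷ q) λ { (k ∷ e) →
      trans (sym (dropˡ (a · (b ∷ q)) (0# ∷ p * (b ∷ q)) (suc k ∷ e)
                        (·-zeroˡ a (b ∷ q) za (suc k ∷ e))))
            (z (suc k ∷ e)) }))
  (λ zb → Sum.map₂
    (λ { zq (zero ∷ e) → zb e ; zq (suc k ∷ e) → zq (k ∷ e) })
    (zero-product (a ∷ p) q λ { (k ∷ e) →
      trans (sym (*-shiftʳ (a ∷ p) b q zb k e)) (z (suc k ∷ e)) }))
  (λ ¬za ¬zb → ⊥-elim ([ ¬za , ¬zb ]′ (zero-product a b λ e →
    trans (sym (dropʳ (a * b) 0# e (coeff-0# e))) (z (zero ∷ e)))))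

1#≉0# : ∀ {n} → 1# {n} ≉ 0#
1#≉0# {n} 1≈0 with trans (sym (coeff-con {n} 1ℤ))
                         (trans (coeff≡ 1≈0 (replicate n 0)) (coeff-0# {n} (replicate n 0)))
... | ()

*-≉0# : ∀ {n} {p q : Poly n} → p ≉ 0# → q ≉ 0# → p * q ≉ 0#
*-≉0# {p = p} {q} p≉0 q≉0 pq≈0
  with zero-product p q (λ e → trans (coeff≡ pq≈0 e) (coeff-0# e))
... | inj₁ zp = p≉0 (mk≈ λ e → trans (zp e) (sym (coeff-0# e)))
... | inj₂ zq = q≉0 (mk≈ λ e → trans (zq e) (sym (coeff-0# e)))

------------------------------------------------------------------------
-- Rational functions: the field of fractions of ℤ[y₀,…,yₙ₋₁], which is
-- ℚ(y₀,…,yₙ₋₁)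

record RatFun (n : ℕ) : Set where
  constructor mkRatFun
  field
    num   : Poly n
    den   : Poly n
    den≉0 : den ≉ 0#

open RatFun public

infix 4 _≃_

record _≃_ {n} (f g : RatFun n) : Set where
  constructor mk≃
  field cross : num f * den g ≈ num g * den f

open _≃_ public

fromPoly : ∀ {n} → Poly n → RatFun n
fromPoly p = mkRatFun p 1# 1#≉0#

infixl 7 _*ʳ_ _÷ʳ_
infixl 6 _+ʳ_ _-ʳ_

_+ʳ_ _-ʳ_ _*ʳ_ : ∀ {n} → RatFun n → RatFun n → RatFun n
f +ʳ g = mkRatFun (num f * den g + num g * den f) (den f * den g) (*-≉0# (den≉0 f) (den≉0 g))
f -ʳ g = mkRatFun (num f * den g - num g * den f) (den f * den g) (*-≉0# (den≉0 f) (den≉0 g))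
f *ʳ g = mkRatFun (num f * num g) (den f * den g) (*-≉0# (den≉0 f) (den≉0 g))

_÷ʳ_ : ∀ {n} → RatFun n → (g : RatFun n) → {num g ≉ 0#} → RatFun n
_÷ʳ_ f g {g≉0} = mkRatFun (num f * den g) (den f * num g) (*-≉0# (den≉0 f) g≉0)

------------------------------------------------------------------------
-- Arithmetic circuits

data Op : Set where
  add sub mul div : Op

-- What a wire may come from, in a circuit over n variables in which m
-- gates are available.
data Source (n m : ℕ) : Set where
  input  : Fin n → Source n m
  scalar : (c : ℕ) .{{_ : ℕ.NonZero c}} → Source n m
  gate   : Fin m → Source n m

-- Gates n s: an acyclic network of s gates over n variables, listed in a
-- topological order.  A gate reads only earlier gates (gate zero is the
-- most recent one), and each gate may be read any number of times.
infixl 5 _▷⟨_⟩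

data Gates (n : ℕ) : ℕ → Set where
  []     : Gates n 0
  _▷⟨_⟩ : ∀ {s} → Gates n s → Op × Source n s × Source n s → Gates n (suc s)

record Circuit (n : ℕ) : Set where
  field
    size   : ℕ
    gates  : Gates n size
    output : Source n size

open Circuit public

value : ∀ {n m} → Vec (RatFun n) m → Source n m → RatFun n
value vs (input i)  = fromPoly (var i)
value vs (scalar c) = fromPoly (con (ℤ.+ c))
value vs (gate j)   = lookup vs j

-- Apply op f g h: the operation op is defined on f and g, with result h.
data Apply {n} : Op → RatFun n → RatFun n → RatFun n → Set where
  add : ∀ {f g} → Apply add f g (f +ʳ g)
  sub : ∀ {f g} → Apply sub f g (f -ʳ g)
  mul : ∀ {f g} → Apply mul f g (f *ʳ g)
  div : ∀ {f g} (g≉0 : num g ≉ 0#) → Apply div f g (_÷ʳ_ f g {g≉0})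

-- Values gs vs: no division by zero occurs in gs, and vs lists the
-- rational functions computed at its gates.
data Values {n} : ∀ {s} → Gates n s → Vec (RatFun n) s → Set where
  []  : Values [] []
  _▷_ : ∀ {s} {gs : Gates n s} {vs op a b v} →
        Values gs vs → Apply op (value vs a) (value vs b) v →
        Values (gs ▷⟨ op , a , b ⟩) (v ∷ vs)

Computes : ∀ {n} → Circuit n → RatFun n → Set
Computes {n} c f =
  Σ[ vs ∈ Vec (RatFun n) (size c) ] Values (gates c) vs × value vs (output c) ≃ f

data NoSub {n} : ∀ {s} → Gates n s → Set where
  []  : NoSub []
  _▷_ : ∀ {s} {gs : Gates n s} {op a b} →
        NoSub gs → ¬ (op ≡ sub) → NoSub (gs ▷⟨ op , a , b ⟩)

------------------------------------------------------------------------
-- Complexity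

Class : Set₁
Class = ∀ {n} → Circuit n → Set

Ordinary : Class
Ordinary _ = ⊤

SubtractionFree : Class
SubtractionFree c = NoSub (gates c)

-- The complexity of f with respect to a class K of circuits is the minimum
-- in ℕ ∪ {∞} of the sizes of the circuits in K computing f.  That minimum
-- is not given as a number, since it cannot be found constructively in
-- general; the following say what it means for it to be finite, to be at
-- most k, and to be greater than k.

FiniteComplexity : Class → ∀ {n} → RatFun n → Set
FiniteComplexity K {n} f = Σ[ c ∈ Circuit n ] K c × Computes c f

Complexity≤ : Class → ∀ {n} → RatFun n → ℕ → Set
Complexity≤ K {n} f k = Σ[ c ∈ Circuit n ] K c × Computes c f × size c ℕ.≤ k

Complexity> : Class → ∀ {n} → RatFun n → ℕ → Set
Complexity> K {n} f k = (c : Circuit n) → K c → Computes c f → k ℕ.< size c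

------------------------------------------------------------------------
-- The polynomials Hₙ

-- Variable 0 is t, and variable i is xᵢ for 1 ≤ i ≤ n.  With n = m + 2, the
-- summation index 2 ≤ i ≤ n - 1 is j + 2 for j : Fin m, so that
-- suc (suc (inject₁ j)) is i and suc (suc (suc j)) is i + 1.
H : ∀ n → 2 ℕ.≤ n → Poly (suc n)
H 1             (s≤s ())
H (suc (suc m)) _ =
    (x₁ - t) ^ 4
  + (x₁ - con (ℤ.+ 2) * x₂) ^ 4
  + sum (λ (j : Fin m) →
      (var (suc (suc (inject₁ j))) ^ 2 - t * var (suc (suc (suc j)))) ^ 2)
  + con (ℤ.+ 4) * (x₁ - t) ^ 2 * xₙ ^ 2
  + con (ℤ.+ 2) * xₙ ^ 4
  where
  open RawSemiringDefinitions (RawRing.rawSemiring (polyRawRing (3 ℕ.+ m)))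
    using (_^_; sum)
  t x₁ x₂ xₙ : Poly (3 ℕ.+ m)
  t  = var zero
  x₁ = var (suc zero)
  x₂ = var (suc (suc zero))
  xₙ = var (fromℕ (2 ℕ.+ m))

{-# OPTIONS --safe #-}

-- Lower bound.  At t = N, x₁ = N + i, x_{j+2} = N / 2^(2^j) with N = 2^(2^(n-2)),
-- the polynomial Hₙ vanishes.  A subtraction-free circuit of size s gives a
-- quotient of polynomials with positive coefficients and degree at most 2^s in x₁,
-- so there its numerator is a sum of powers (N + i)^k with k ≤ 2^s.  As
-- arg (N + i) is about 1/N, these have positive real part when 2^s ≤ N.
--
-- Finiteness.  If g is bounded by s, then s² + k g² is a quotient of positive
-- polynomials for every k, so sums of squares of forms bounded by B σ² are
-- nonnegative up to ε σ⁴, where σ is a positive combination of the variables.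
-- Going through the squares in Hₙ from xₙ down to x₂, x₁, t, each of
-- σ³xₙ, …, σ³x₁, σ³t is at most ε σ⁴ + C Hₙ.  Summing gives σ⁴ ≤ ε σ⁴ + C Hₙ,
-- which for ε < 1 exhibits Hₙ as a quotient of positive polynomials.
module Submission where

open import Algebra.Bundles using (CommutativeMonoid; CommutativeRing; RawRing; Ring)
import Algebra.Definitions.RawSemiring as RawSemiringDefinitions
import Algebra.Properties.CommutativeSemigroup as CommutativeSemigroupProperties
import Algebra.Properties.Ring as RingProperties
import Algebra.Properties.Semiring.Exp as Exp
import Algebra.Solver.Ring
import Algebra.Solver.Ring.AlmostCommutativeRing as ACR
open import Data.Fin.Base using (Fin; zero; suc; inject₁; fromℕ; toℕ)
open import Data.Fin.Induction using (>-weakInduction)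
import Data.Fin.Properties as Fin
open import Data.Integer.Base as ℤ using (ℤ; 0ℤ; 1ℤ; +≤+; +<+)
import Data.Integer.Properties as ℤ
import Data.Integer.Solver as ℤ-Solver
open import Data.Maybe.Base as Maybe using (Maybe)
open import Data.Nat.Base as ℕ using (ℕ; zero; suc; z≤n; s≤s; _≤_; _∸_)
import Data.Nat.Properties as ℕ
import Data.Nat.Solver as ℕ-Solver
open import Data.Product.Base using (_×_; _,_; proj₁; proj₂; ∃-syntax)
open import Data.Unit.Base using (⊤; tt)
open import Data.Vec.Base using (Vec; []; _∷_; lookup)
open import Data.Vec.Functional using (foldr; tail)
import Defs as P
open import Level using (0ℓ)
open import Relation.Binary.Bundles using (Setoid)
open import Relation.Binary.PropositionalEquality as ≡ using (_≡_)
import Relation.Binary.Reasoning.Setoid as SetoidReasoning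
open import Relation.Nullary using (¬_; contradiction)
open import Relation.Nullary.Decidable using (dec⇒maybe)

-- The point is dictated by the shape of Hₙ: with x₁ - t = x₁ - 2 x₂ = i, all links xᵢ² = t xᵢ₊₁
-- satisfied and xₙ = 1, what remains is i⁴ + i⁴ + 4 i² + 2 = 0. Along the links the power of 2
-- separating xᵢ from t doubles its exponent each time, so reaching xₙ = 1 after n - 2 links takes t
-- doubly exponential in n, while the imaginary part of x₁ stays 1. Every coordinate but x₁ is a
-- positive integer, hence only the degree in x₁ matters, and a gate at most doubles the common
-- bound for numerators and denominators.
--
-- For finiteness the obstacle is that a square such as (x₁ - t)⁴ vanishes at positive points,
-- whereas a quotient of positive polynomials is positive there. Such a summand cannot be certified
-- alone; the slack ε σ⁴ makes each one admissible, and it is cancelled only once, after every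
-- variable has been dominated.

ℤ-Morphism : CommutativeRing 0ℓ 0ℓ → Set
ℤ-Morphism R = ℤ.+-*-rawRing ACR.-Raw-AlmostCommutative⟶ ACR.fromCommutativeRing R

module ℤ-CoefficientSolver {R : CommutativeRing 0ℓ 0ℓ} (ι : ℤ-Morphism R) where
  open CommutativeRing R using (_≈_; refl)
  open ACR._-Raw-AlmostCommutative⟶_ ι

  private
    ⟦⟧-cong : ∀ {a b} → a ≡ b → ⟦ a ⟧ ≈ ⟦ b ⟧
    ⟦⟧-cong ≡.refl = refl

  open Algebra.Solver.Ring ℤ.+-*-rawRing (ACR.fromCommutativeRing R) ι
    (λ a b → Maybe.map ⟦⟧-cong (dec⇒maybe (a ℤ.≟ b))) public
    using (solve; _:+_; _:*_; _:-_; :-_; _:=_) renaming (con to :con)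

-- Hₙ is quartic 4 2 (x₁ - t) (x₁ - 2 x₂) (λ i → xᵢ² - t xᵢ₊₁) xₙ.
module Quartic (R : RawRing 0ℓ 0ℓ) where
  open RawRing R using (Carrier; _+_; _*_; rawSemiring)
  open RawSemiringDefinitions rawSemiring using (_^_; sum)

  quartic : Carrier → Carrier → Carrier → Carrier → ∀ {m} → (Fin m → Carrier) → Carrier → Carrier
  quartic four two a b c x =
    a ^ 4 + b ^ 4 + sum (λ j → c j ^ 2) + four * a ^ 2 * x ^ 2 + two * x ^ 4

-- Quotients of positive elements

record PositiveCone (R : CommutativeRing 0ℓ 0ℓ) (ι : ℤ-Morphism R) : Set₁ where
  open CommutativeRing R using (Carrier; _+_; _*_)
  open ACR._-Raw-AlmostCommutative⟶_ ι using () renaming (⟦_⟧ to con)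
  infixl 7 _*⁺_
  infixl 6 _+⁺_
  field
    Positive : Carrier → Set
    con⁺     : ∀ k → Positive (con (ℤ.+ suc k))
    _+⁺_     : ∀ {p q} → Positive p → Positive q → Positive (p + q)
    _*⁺_     : ∀ {p q} → Positive p → Positive q → Positive (p * q)

module PositiveRatios
  {R : CommutativeRing 0ℓ 0ℓ} {ι : ℤ-Morphism R} (P : PositiveCone R ι)
  where

  open CommutativeRing R hiding (zero)
  open PositiveCone P
  open ACR._-Raw-AlmostCommutative⟶_ ι
    using ()
    renaming (⟦_⟧ to con; +-homo to con-+; *-homo to con-*; 0-homo to con-0; 1-homo to con-1)
  open Quartic (Ring.rawRing ring) using (quartic)
  open RawSemiringDefinitions (RawRing.rawSemiring (Ring.rawRing ring)) using (_^_; sum)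
  open SetoidReasoning setoid

  open ℤ-CoefficientSolver ι

  record Ratio⁺ (p : Carrier) : Set where
    constructor ratio
    field
      {divisor dividend} : Carrier
      divisor⁺           : Positive divisor
      dividend⁺          : Positive dividend
      quotient           : divisor * p ≈ dividend

  ratio-resp : ∀ {p q} → p ≈ q → Ratio⁺ p → Ratio⁺ q
  ratio-resp p≈q (ratio a⁺ b⁺ eq) = ratio a⁺ b⁺ (trans (*-cong refl (sym p≈q)) eq)

  ratio-positive : ∀ {p} → Positive p → Ratio⁺ p
  ratio-positive p⁺ = ratio (con⁺ 0) p⁺ (trans (*-congʳ con-1) (*-identityˡ _))

  ratio-+ : ∀ {p q} → Ratio⁺ p → Ratio⁺ q → Ratio⁺ (p + q)
  ratio-+ {p} {q} (ratio {a} {b} a⁺ b⁺ ap≈b) (ratio {c} {d} c⁺ d⁺ cq≈d) =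
    ratio (a⁺ *⁺ c⁺) ((b⁺ *⁺ c⁺) +⁺ (a⁺ *⁺ d⁺)) (begin
      (a * c) * (p + q)          ≈⟨ solve 4 (λ a c p q →
        (a :* c) :* (p :+ q) := (a :* p) :* c :+ a :* (c :* q)) refl a c p q ⟩
      (a * p) * c + a * (c * q)  ≈⟨ +-cong (*-cong ap≈b refl) (*-cong refl cq≈d) ⟩
      b * c + a * d              ∎)

  ratio-* : ∀ {p q} → Ratio⁺ p → Ratio⁺ q → Ratio⁺ (p * q)
  ratio-* {p} {q} (ratio {a} {b} a⁺ b⁺ ap≈b) (ratio {c} {d} c⁺ d⁺ cq≈d) =
    ratio (a⁺ *⁺ c⁺) (b⁺ *⁺ d⁺) (begin
      (a * c) * (p * q)  ≈⟨ solve 4 (λ a c p q →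
        (a :* c) :* (p :* q) := (a :* p) :* (c :* q)) refl a c p q ⟩
      (a * p) * (c * q)  ≈⟨ *-cong ap≈b cq≈d ⟩
      b * d              ∎)

  -- This is how positive factors are cancelled: the certificates below write a multiple of the
  -- target as a sum of products of `Ratio⁺` elements and then divide.
  ratio-÷ : ∀ {p q} → Ratio⁺ p → Ratio⁺ (p * q) → Ratio⁺ q
  ratio-÷ {p} {q} (ratio {a} {b} a⁺ b⁺ ap≈b) (ratio {c} {d} c⁺ d⁺ cpq≈d) =
    ratio (c⁺ *⁺ b⁺) (a⁺ *⁺ d⁺) (begin
      (c * b) * q        ≈⟨ *-cong (*-cong refl ap≈b) refl ⟨
      (c * (a * p)) * q  ≈⟨ solve 4 (λ a c p q →
        (c :* (a :* p)) :* q := a :* (c :* (p :* q))) refl a c p q ⟩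
      a * (c * (p * q))  ≈⟨ *-cong refl cpq≈d ⟩
      a * d              ∎)

  -- The index is one less than the constant, here and in `scalar-con`: `ratio-con 3` certifies 4.
  ratio-con : ∀ k → Ratio⁺ (con (ℤ.+ suc k))
  ratio-con k = ratio-positive (con⁺ k)

  ratio-half : ∀ {p q} → con (ℤ.+ 2) * q ≈ p → Ratio⁺ p → Ratio⁺ q
  ratio-half eq Fp = ratio-÷ (ratio-con 1) (ratio-resp (sym eq) Fp)

  -- The constant is k + 1.  Passing from (s , g) to (s² + g² , 2sg) squares
  -- s + g and s - g.
  ratio-square : ∀ k {s g} → Ratio⁺ (s + g) → Ratio⁺ (s - g) →
                 Ratio⁺ (s * s + con (ℤ.+ suc k) * (g * g))
  ratio-square zero {s} {g} F+ F- = ratio-half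
    (solve 2 (λ s g → :con (ℤ.+ 2) :* (s :* s :+ :con (ℤ.+ 1) :* (g :* g))
       := (s :+ g) :* (s :+ g) :+ (s :- g) :* (s :- g)) refl s g)
    (ratio-+ (ratio-* F+ F+) (ratio-* F- F-))
  ratio-square (suc k) {s} {g} F+ F- = ratio-resp
    (+-cong refl (*-cong (sym (con-+ 1ℤ (ℤ.+ suc k))) refl))
    (ratio-÷ (ratio-* (ratio-* (ratio-con 3) (ratio-con k))
                      (ratio-+ (ratio-* (ratio-con k) (ratio-* Fs Fs)) F²))
      (ratio-resp
        -- Here c = k + 1. The weight 3c² + 4c on s′² is the one that makes the left side vanish at
        -- s² = -(1 + c) g², so that s² + (1 + c) g² splits off. The cofactor 4c (c s² + s′) is a
        -- `Ratio⁺`, hence can be divided out.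
        (solve 3 (λ c s g →
          let g′ = :con (ℤ.+ 2) :* s :* g
              s′ = s :* s :+ :con (ℤ.+ 1) :* (g :* g)
          in (c :* c) :* (s′ :* s′ :+ c :* (g′ :* g′))
             :+ (:con (ℤ.+ 3) :* (c :* c) :+ :con (ℤ.+ 4) :* c) :* (s′ :* s′)
          := ((:con (ℤ.+ 4) :* c) :* (c :* (s :* s) :+ s′))
             :* (s :* s :+ (:con 1ℤ :+ c) :* (g :* g)))
          refl (con (ℤ.+ suc k)) s g)
        (ratio-+ (ratio-* (ratio-* (ratio-con k) (ratio-con k)) (ratio-square k
               (ratio-resp (solve 2 (λ s g → (s :+ g) :* (s :+ g) :=
                  s :* s :+ :con (ℤ.+ 1) :* (g :* g) :+ :con (ℤ.+ 2) :* s :* g)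
                  refl s g) (ratio-* F+ F+))
               (ratio-resp (solve 2 (λ s g → (s :- g) :* (s :- g) :=
                  s :* s :+ :con (ℤ.+ 1) :* (g :* g) :- :con (ℤ.+ 2) :* s :* g)
                  refl s g) (ratio-* F- F-))))
             (ratio-* (ratio-+ (ratio-* (ratio-con 2) (ratio-* (ratio-con k) (ratio-con k)))
                               (ratio-* (ratio-con 3) (ratio-con k)))
                  (ratio-* F² F²)))))
    where
    Fs : Ratio⁺ s
    Fs = ratio-half (solve 2 (λ s g → :con (ℤ.+ 2) :* s := (s :+ g) :+ (s :- g)) refl s g)
           (ratio-+ F+ F-)
    F² : Ratio⁺ (s * s + con (ℤ.+ 1) * (g * g))
    F² = ratio-square zero F+ F-

  -- Positive integer scalars and two-sided bounds

  Scalar : Carrier → Set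
  Scalar c = ∃[ k ] c ≈ con (ℤ.+ suc k)

  scalar-con : ∀ k → Scalar (con (ℤ.+ suc k))
  scalar-con k = k , refl

  scalar-+ : ∀ {c d} → Scalar c → Scalar d → Scalar (c + d)
  scalar-+ (k , c≈) (l , d≈) =
    k ℕ.+ suc l , trans (+-cong c≈ d≈) (sym (con-+ (ℤ.+ suc k) (ℤ.+ suc l)))

  scalar-* : ∀ {c d} → Scalar c → Scalar d → Scalar (c * d)
  scalar-* (k , c≈) (l , d≈) =
    l ℕ.+ k ℕ.* suc l , trans (*-cong c≈ d≈) (sym (con-* (ℤ.+ suc k) (ℤ.+ suc l)))

  ratio-scalar : ∀ {c} → Scalar c → Ratio⁺ c
  ratio-scalar (k , c≈) = ratio-resp (sym c≈) (ratio-con k)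

  ratio-square-scalar : ∀ {c s g} → Scalar c → Ratio⁺ (s + g) → Ratio⁺ (s - g) →
                        Ratio⁺ (s * s + c * (g * g))
  ratio-square-scalar (k , c≈) F+ F- =
    ratio-resp (+-cong refl (*-cong (sym c≈) refl)) (ratio-square k F+ F-)

  -- Bounded s c: |c| < B s for some B.
  record Bounded (s c : Carrier) : Set where
    constructor bounded
    field
      {bound} : Carrier
      bound⁺  : Scalar bound
      upper   : Ratio⁺ (bound * s - c)
      lower   : Ratio⁺ (bound * s + c)

  Bounded-resp : ∀ {s c d} → c ≈ d → Bounded s c → Bounded s d
  Bounded-resp c≈d (bounded B⁺ up lo) = bounded B⁺
    (ratio-resp (+-cong refl (-‿cong c≈d)) up) (ratio-resp (+-cong refl c≈d) lo)

  Bounded-+ : ∀ {s c d} → Bounded s c → Bounded s d → Bounded s (c + d)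
  Bounded-+ {s} {c} {d} (bounded {B} B⁺ up lo) (bounded {D} D⁺ up′ lo′) =
    bounded (scalar-+ B⁺ D⁺)
      (ratio-resp (solve 5 (λ B D s c d → (B :* s :- c) :+ (D :* s :- d) :=
         (B :+ D) :* s :- (c :+ d)) refl B D s c d) (ratio-+ up up′))
      (ratio-resp (solve 5 (λ B D s c d → (B :* s :+ c) :+ (D :* s :+ d) :=
         (B :+ D) :* s :+ (c :+ d)) refl B D s c d) (ratio-+ lo lo′))

  Bounded-neg : ∀ {s c} → Bounded s c → Bounded s (- c)
  Bounded-neg {s} {c} (bounded {B} B⁺ up lo) = bounded B⁺
    (ratio-resp (solve 3 (λ B s c → B :* s :+ c := B :* s :- (:- c)) refl B s c) lo)
    up

  Bounded-- : ∀ {s c d} → Bounded s c → Bounded s d → Bounded s (c - d)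
  Bounded-- c< d< = Bounded-+ c< (Bounded-neg d<)

  -- Products of one gap `B s ± c` with one gap `D s′ ± d` are added in pairs so that the mixed
  -- terms cancel, which leaves twice the gap for `c * d`.
  Bounded-* : ∀ {s s′ c d} → Bounded s c → Bounded s′ d → Bounded (s * s′) (c * d)
  Bounded-* {s} {s′} {c} {d} (bounded {B} B⁺ up lo) (bounded {D} D⁺ up′ lo′) =
    bounded (scalar-* B⁺ D⁺)
      (ratio-half (solve 6 (λ B D s s′ c d → :con (ℤ.+ 2) :* (B :* D :* (s :* s′) :- c :* d) :=
         (B :* s :- c) :* (D :* s′ :+ d) :+ (B :* s :+ c) :* (D :* s′ :- d)) refl B D s s′ c d)
         (ratio-+ (ratio-* up lo′) (ratio-* lo up′)))
      (ratio-half (solve 6 (λ B D s s′ c d → :con (ℤ.+ 2) :* (B :* D :* (s :* s′) :+ c :* d) :=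
         (B :* s :- c) :* (D :* s′ :- d) :+ (B :* s :+ c) :* (D :* s′ :+ d)) refl B D s s′ c d)
         (ratio-+ (ratio-* up up′) (ratio-* lo lo′)))

  Bounded-scale : ∀ {k s c} → Scalar k → Bounded s c → Bounded s (k * c)
  Bounded-scale {k} {s} {c} k⁺ (bounded {B} B⁺ up lo) = bounded (scalar-* k⁺ B⁺)
    (ratio-resp (solve 4 (λ k B s c → k :* (B :* s :- c) := (k :* B) :* s :- k :* c)
       refl k B s c) (ratio-* (ratio-scalar k⁺) up))
    (ratio-resp (solve 4 (λ k B s c → k :* (B :* s :+ c) := (k :* B) :* s :+ k :* c)
       refl k B s c) (ratio-* (ratio-scalar k⁺) lo))

  Bounded-refl : ∀ {s} → Ratio⁺ s → Bounded s s
  Bounded-refl {s} Fs = bounded (scalar-con 1)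
    (ratio-resp (solve 1 (λ s → s := :con (ℤ.+ 2) :* s :- s) refl s) Fs)
    (ratio-+ (ratio-* (ratio-con 1) Fs) Fs)

  -- Nonnegativity and domination with slack in σ⁴

  module _ {σ : Carrier} (Fσ : Ratio⁺ σ) where

    σ² σ⁴ : Carrier
    σ² = σ * σ
    σ⁴ = σ² * σ²

    Fσ² : Ratio⁺ σ²
    Fσ² = ratio-* Fσ Fσ

    Fσ⁴ : Ratio⁺ σ⁴
    Fσ⁴ = ratio-* Fσ² Fσ²

    -- f ≥ - ε σ⁴ for every ε > 0.
    AlmostNonneg : Carrier → Set
    AlmostNonneg f = ∀ {c} → Scalar c → Ratio⁺ (σ⁴ + c * f)

    infix 4 _≼_
    _≼_ : Carrier → Carrier → Set
    f ≼ g = AlmostNonneg (g - f)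

    nonneg-resp : ∀ {f g} → f ≈ g → AlmostNonneg f → AlmostNonneg g
    nonneg-resp f≈g f≥0 c⁺ = ratio-resp (+-cong refl (*-cong refl f≈g)) (f≥0 c⁺)

    nonneg-F : ∀ {f} → Ratio⁺ f → AlmostNonneg f
    nonneg-F Ff c⁺ = ratio-+ Fσ⁴ (ratio-* (ratio-scalar c⁺) Ff)

    nonneg-0# : AlmostNonneg 0#
    nonneg-0# {c} _ = ratio-resp
      (sym (trans (+-cong refl (zeroʳ c)) (+-identityʳ σ⁴))) Fσ⁴

    -- The slack is shared: each summand is used with coefficient `2c`, that is, with half of σ⁴.
    -- `dominated-≼` and `dominated-+` double their coefficients for the same reason.
    nonneg-+ : ∀ {f g} → AlmostNonneg f → AlmostNonneg g → AlmostNonneg (f + g)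
    nonneg-+ {f} {g} f≥0 g≥0 {c} c⁺ = ratio-half
      (solve 4 (λ z c f g → :con (ℤ.+ 2) :* (z :+ c :* (f :+ g)) :=
         (z :+ :con (ℤ.+ 2) :* c :* f) :+ (z :+ :con (ℤ.+ 2) :* c :* g)) refl σ⁴ c f g)
      (ratio-+ (f≥0 2c⁺) (g≥0 2c⁺))
      where
      2c⁺ = scalar-* (scalar-con 1) c⁺

    -- After multiplication by B² the claim concerns (B σ²)² + k B² c², where `B * σ²` bounds `c`.
    -- The coefficient k B² is arbitrarily large, which is why `ratio-square` is proved for every
    -- constant.
    nonneg-square : ∀ {c} → Bounded σ² c → AlmostNonneg (c * c)
    nonneg-square {c} (bounded {B} B⁺ up lo) {k} k⁺ =
      ratio-÷ (ratio-* (ratio-scalar B⁺) (ratio-scalar B⁺))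
        (ratio-resp (solve 4 (λ B z k c →
           (B :* z) :* (B :* z) :+ k :* (B :* B) :* (c :* c) :=
           B :* B :* (z :* z :+ k :* (c :* c))) refl B σ² k c)
          (ratio-square-scalar (scalar-* k⁺ (scalar-* B⁺ B⁺)) lo up))

    nonneg-scale : ∀ {k f} → Scalar k → AlmostNonneg f → AlmostNonneg (k * f)
    nonneg-scale {k} {f} k⁺ f≥0 {c} c⁺ = ratio-resp
      (+-cong refl (*-assoc c k f)) (f≥0 (scalar-* c⁺ k⁺))

    ≼-refl : ∀ {f} → f ≼ f
    ≼-refl {f} = nonneg-resp (sym (-‿inverseʳ f)) nonneg-0#

    ≼-+ʳ : ∀ {f g h} → f ≼ g → AlmostNonneg h → f ≼ g + h
    ≼-+ʳ {f} {g} {h} f≼g h≥0 = nonneg-resp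
      (solve 3 (λ f g h → (g :- f) :+ h := (g :+ h) :- f) refl f g h) (nonneg-+ f≼g h≥0)

    ≼-+ˡ : ∀ {f g h} → AlmostNonneg g → f ≼ h → f ≼ g + h
    ≼-+ˡ {f} {g} {h} g≥0 f≼h = nonneg-resp
      (solve 3 (λ f g h → g :+ (h :- f) := (g :+ h) :- f) refl f g h) (nonneg-+ g≥0 f≼h)

    nonneg-sum : ∀ {m} (f : Fin m → Carrier) → (∀ i → AlmostNonneg (f i)) → AlmostNonneg (sum f)
    nonneg-sum {zero}  f f≥0 = nonneg-0#
    nonneg-sum {suc m} f f≥0 = nonneg-+ (f≥0 zero) (nonneg-sum (tail f) (λ i → f≥0 (suc i)))

    ≼-sum : ∀ {m} (f : Fin m → Carrier) → (∀ i → AlmostNonneg (f i)) → ∀ i → f i ≼ sum f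
    ≼-sum f f≥0 zero    = ≼-+ʳ ≼-refl (nonneg-sum (tail f) (λ i → f≥0 (suc i)))
    ≼-sum f f≥0 (suc i) = ≼-+ˡ (f≥0 zero) (≼-sum (tail f) (λ i → f≥0 (suc i)) i)

    module _ {h : Carrier} where

      -- For every ε > 0 there is C with f ≤ ε σ⁴ + C h.
      Dominated : Carrier → Set
      Dominated f = ∀ {c} → Scalar c → ∃[ u ] ∃[ v ]
        Ratio⁺ u × Ratio⁺ v × Ratio⁺ (u * (σ⁴ - c * f) + v * h)

      dominated-resp : ∀ {f g} → f ≈ g → Dominated f → Dominated g
      dominated-resp f≈g f< c⁺ with f< c⁺
      ... | u , v , Fu , Fv , Fw = u , v , Fu , Fv ,
        ratio-resp (+-cong (*-cong refl (+-cong refl (-‿cong (*-cong refl f≈g)))) refl) Fw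

      ≼⇒dominated : ∀ {f} → f ≼ h → Dominated f
      ≼⇒dominated {f} f≼h {c} c⁺ = con (ℤ.+ 1) , c , ratio-con 0 , ratio-scalar c⁺ ,
        ratio-resp (solve 4 (λ z c f h →
          z :+ c :* (h :- f) := :con 1ℤ :* (z :- c :* f) :+ c :* h) refl σ⁴ c f h) (f≼h c⁺)

      dominated-≼ : ∀ {f g} → f ≼ g → Dominated g → Dominated f
      dominated-≼ {f} {g} f≼g g< {c} c⁺ with g< (scalar-* (scalar-con 1) c⁺)
      ... | u , v , Fu , Fv , Fw = con (ℤ.+ 2) * u , v , ratio-* (ratio-con 1) Fu , Fv ,
        ratio-resp (solve 7 (λ z c f g h u v →
          (u :* (z :- :con (ℤ.+ 2) :* c :* g) :+ v :* h)
          :+ u :* (z :+ :con (ℤ.+ 2) :* c :* (g :- f))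
          := :con (ℤ.+ 2) :* u :* (z :- c :* f) :+ v :* h) refl σ⁴ c f g h u v)
          (ratio-+ Fw (ratio-* Fu (f≼g (scalar-* (scalar-con 1) c⁺))))

      dominated-+ : ∀ {f g} → Dominated f → Dominated g → Dominated (f + g)
      dominated-+ {f} {g} f< g< {c} c⁺
        with f< (scalar-* (scalar-con 1) c⁺) | g< (scalar-* (scalar-con 1) c⁺)
      ... | u , v , Fu , Fv , Fw | u′ , v′ , Fu′ , Fv′ , Fw′ =
        con (ℤ.+ 2) * u * u′ , u′ * v + u * v′ ,
        ratio-* (ratio-* (ratio-con 1) Fu) Fu′ , ratio-+ (ratio-* Fu′ Fv) (ratio-* Fu Fv′) ,
        ratio-resp (solve 9 (λ z c f g h u v u′ v′ →
          u′ :* (u :* (z :- :con (ℤ.+ 2) :* c :* f) :+ v :* h)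
          :+ u :* (u′ :* (z :- :con (ℤ.+ 2) :* c :* g) :+ v′ :* h)
          := :con (ℤ.+ 2) :* u :* u′ :* (z :- c :* (f :+ g)) :+ (u′ :* v :+ u :* v′) :* h)
          refl σ⁴ c f g h u v u′ v′)
          (ratio-+ (ratio-* Fu′ Fw) (ratio-* Fu Fw′))

      -- k σ² c ≤ σ⁴ / 4 + k² c², by (σ² - 2 k c)² ≥ 0.
      dominated-root : ∀ {c} → Bounded σ² c → Dominated (c * c) → Dominated (σ² * c)
      dominated-root {c} c< c²< {k} k⁺
        with c²< (scalar-* (scalar-con 3) (scalar-* k⁺ k⁺))
      ... | u , v , Fu , Fv , Fw = con (ℤ.+ 4) * u , v , ratio-* (ratio-con 3) Fu , Fv ,
        ratio-resp (solve 6 (λ s c k h u v →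
          let g = s :- :con (ℤ.+ 2) :* k :* c in
          u :* (s :* s :+ :con (ℤ.+ 1) :* (g :* g)) :+ u :* (s :* s)
          :+ (u :* (s :* s :- :con (ℤ.+ 4) :* (k :* k) :* (c :* c)) :+ v :* h)
          := :con (ℤ.+ 4) :* u :* (s :* s :- k :* (s :* c)) :+ v :* h) refl σ² c k h u v)
          (ratio-+ (ratio-+ (ratio-* Fu (nonneg-square
                       (Bounded-- (Bounded-refl Fσ²)
                         (Bounded-scale (scalar-* (scalar-con 1) k⁺) c<))
                       (scalar-con 0)))
                    (ratio-* Fu Fσ⁴)) Fw)

      dominated-σ⁴⇒F : Dominated σ⁴ → Ratio⁺ h
      -- The coefficient 2 amounts to ε = 1/2: adding u σ⁴ to u (σ⁴ - 2 σ⁴) + v h leaves v h, and v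
      -- is divided out.
      dominated-σ⁴⇒F σ⁴< with σ⁴< (scalar-con 1)
      ... | u , v , Fu , Fv , Fw = ratio-÷ Fv
        (ratio-resp (solve 4 (λ z h u v →
          (u :* (z :- :con (ℤ.+ 2) :* z) :+ v :* h) :+ u :* z := v :* h) refl σ⁴ h u v)
          (ratio-+ Fw (ratio-* Fu Fσ⁴)))

      -- This takes the root of σ² x² = (σ x)². Powers of σ pad everything to degree four, so that
      -- all comparisons are against the same σ⁴.
      dominated-linear : ∀ {x} → Bounded σ x → Dominated (σ² * (x * x)) → Dominated (σ² * (σ * x))
      dominated-linear {x} x< x²< = dominated-root (Bounded-* (Bounded-refl Fσ) x<)
        (dominated-resp (solve 2 (λ σ x →
          σ :* σ :* (x :* x) := (σ :* x) :* (σ :* x)) refl σ x) x²<)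

  -- The quartic as a quotient of positive elements

  ratio-sum : ∀ {m t} (x : Fin m → Carrier) → Ratio⁺ t → (∀ j → Ratio⁺ (x j)) → Ratio⁺ (foldr _+_ t x)
  ratio-sum {zero}  x Ft Fx = Ft
  ratio-sum {suc m} x Ft Fx = ratio-+ (Fx zero) (ratio-sum (tail x) Ft (λ j → Fx (suc j)))

  -- The fold starts from `t` rather than 0, so something positive is left even when the only
  -- summand is removed. As a result `t` is counted twice in the `σ` used for the quartic.
  ratio-sum-minus : ∀ {m t} (x : Fin m → Carrier) → Ratio⁺ t → (∀ j → Ratio⁺ (x j)) →
                ∀ j → Ratio⁺ (foldr _+_ t x - x j)
  ratio-sum-minus {t = t} x Ft Fx zero = ratio-resp
    (solve 2 (λ x s → s := (x :+ s) :- x) refl (x zero) (foldr _+_ t (tail x)))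
    (ratio-sum (tail x) Ft (λ j → Fx (suc j)))
  ratio-sum-minus {t = t} x Ft Fx (suc j) = ratio-resp
    (solve 3 (λ x s y → x :+ (s :- y) := (x :+ s) :- y) refl
      (x zero) (foldr _+_ t (tail x)) (x (suc j)))
    (ratio-+ (Fx zero) (ratio-sum-minus (tail x) Ft (λ j → Fx (suc j)) j))

  ^2≈ : ∀ x → x ^ 2 ≈ x * x
  ^2≈ x = *-congˡ (*-identityʳ x)

  ^4≈ : ∀ x → x ^ 4 ≈ (x * x) * (x * x)
  ^4≈ x = trans (*-congˡ (*-congˡ (^2≈ x))) (sym (*-assoc x x (x * x)))

  module _ {m : ℕ} {t x₁ : Carrier} (x : Fin (suc m) → Carrier)
           (Ft : Ratio⁺ t) (Fx₁ : Ratio⁺ x₁) (Fx : ∀ j → Ratio⁺ (x j)) where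

    private
      σ Σx x₂ xₙ a b h : Carrier
      Σx = foldr _+_ t x
      σ  = t + (x₁ + Σx)
      x₂ = x zero
      xₙ = x (fromℕ m)
      a  = x₁ - t
      b  = x₁ - con (ℤ.+ 2) * x₂

      c : Fin m → Carrier
      c j = x (inject₁ j) ^ 2 - t * x (suc j)

      h  = quartic (con (ℤ.+ 4)) (con (ℤ.+ 2)) a b c xₙ

      FΣx : Ratio⁺ Σx
      FΣx = ratio-sum x Ft Fx

      Fσ : Ratio⁺ σ
      Fσ = ratio-+ Ft (ratio-+ Fx₁ FΣx)

      ratio-σ-t : Ratio⁺ (σ - t)
      ratio-σ-t = ratio-resp (solve 3 (λ t y s → y :+ s := (t :+ (y :+ s)) :- t) refl t x₁ Σx)
        (ratio-+ Fx₁ FΣx)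

      bounded-summand : ∀ {y} → Ratio⁺ y → Ratio⁺ (σ - y) → Bounded σ y
      bounded-summand {y} Fy Fσ-y = bounded (scalar-con 0)
        (ratio-resp (solve 2 (λ σ y → σ :- y := :con 1ℤ :* σ :- y) refl σ y) Fσ-y)
        (ratio-+ (ratio-* (ratio-con 0) Fσ) Fy)

      t< : Bounded σ t
      t< = bounded-summand Ft ratio-σ-t

      x₁< : Bounded σ x₁
      x₁< = bounded-summand Fx₁
        (ratio-resp (solve 3 (λ t y s → t :+ s := (t :+ (y :+ s)) :- y) refl t x₁ Σx)
          (ratio-+ Ft FΣx))

      x< : ∀ j → Bounded σ (x j)
      x< j = bounded-summand (Fx j)
        (ratio-resp (solve 4 (λ t y s z → t :+ (y :+ (s :- z)) := (t :+ (y :+ s)) :- z)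
           refl t x₁ Σx (x j))
          (ratio-+ Ft (ratio-+ Fx₁ (ratio-sum-minus x Ft Fx j))))

      a< : Bounded σ a
      a< = Bounded-- x₁< t<

      b< : Bounded σ b
      b< = Bounded-- x₁< (Bounded-scale (scalar-con 1) (x< zero))

      c< : ∀ j → Bounded (σ * σ) (c j)
      c< j = Bounded-- (Bounded-resp (sym (^2≈ (x (inject₁ j)))) (Bounded-* (x< (inject₁ j)) (x< (inject₁ j))))
                       (Bounded-* t< (x< (suc j)))

      nonneg-fourth : ∀ {y} → Bounded σ y → AlmostNonneg Fσ (y ^ 4)
      nonneg-fourth {y} y< = nonneg-resp Fσ (sym (^4≈ y)) (nonneg-square Fσ (Bounded-* y< y<))

      nonneg-c : ∀ j → AlmostNonneg Fσ (c j ^ 2)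
      nonneg-c j = nonneg-resp Fσ (sym (^2≈ (c j))) (nonneg-square Fσ (c< j))

      nonneg-Σc : AlmostNonneg Fσ (sum (λ j → c j ^ 2))
      nonneg-Σc = nonneg-sum Fσ (λ j → c j ^ 2) nonneg-c

      nonneg-mixed : AlmostNonneg Fσ (con (ℤ.+ 4) * a ^ 2 * xₙ ^ 2)
      nonneg-mixed = nonneg-resp Fσ
        (trans (solve 2 (λ a x → :con (ℤ.+ 4) :* ((a :* x) :* (a :* x)) :=
                  :con (ℤ.+ 4) :* (a :* a) :* (x :* x)) refl a xₙ)
               (*-cong (*-congˡ (sym (^2≈ a))) (sym (^2≈ xₙ))))
        (nonneg-scale Fσ (scalar-con 3) (nonneg-square Fσ (Bounded-* a< (x< (fromℕ m)))))

      nonneg-last : AlmostNonneg Fσ (con (ℤ.+ 2) * xₙ ^ 4)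
      nonneg-last = nonneg-scale Fσ (scalar-con 1) (nonneg-fourth (x< (fromℕ m)))

      infix 4 _≼′_
      _≼′_ : Carrier → Carrier → Set
      _≼′_ = _≼_ Fσ

      ≼-respˡ : ∀ {f g k} → f ≈ g → f ≼′ k → g ≼′ k
      ≼-respˡ f≈g = nonneg-resp Fσ (+-congˡ (-‿cong f≈g))

      a≼h : (a * a) * (a * a) ≼′ h
      a≼h = ≼-respˡ (^4≈ a) (≼-+ʳ Fσ (≼-+ʳ Fσ (≼-+ʳ Fσ (≼-+ʳ Fσ (≼-refl Fσ)
        (nonneg-fourth b<)) nonneg-Σc) nonneg-mixed) nonneg-last)

      b≼h : (b * b) * (b * b) ≼′ h
      b≼h = ≼-respˡ (^4≈ b) (≼-+ʳ Fσ (≼-+ʳ Fσ (≼-+ʳ Fσ (≼-+ˡ Fσ (nonneg-fourth a<)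
        (≼-refl Fσ)) nonneg-Σc) nonneg-mixed) nonneg-last)

      c≼h : ∀ j → c j * c j ≼′ h
      c≼h j = ≼-respˡ (^2≈ (c j)) (≼-+ʳ Fσ (≼-+ʳ Fσ (≼-+ˡ Fσ
        (nonneg-+ Fσ (nonneg-fourth a<) (nonneg-fourth b<))
        (≼-sum Fσ (λ j → c j ^ 2) nonneg-c j)) nonneg-mixed) nonneg-last)

      xₙ≼h : (xₙ * xₙ) * (xₙ * xₙ) ≼′ h
      xₙ≼h = ≼-respˡ (^4≈ xₙ) (≼-+ˡ Fσ
        (nonneg-+ Fσ (nonneg-+ Fσ (nonneg-+ Fσ (nonneg-fourth a<) (nonneg-fourth b<)) nonneg-Σc)
          nonneg-mixed)
        -- One of the two copies of xₙ⁴ is compared with; the other is nonnegative up to slack.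
        (nonneg-resp Fσ (solve 1 (λ y → y := :con (ℤ.+ 2) :* y :- y) refl (xₙ ^ 4))
          (nonneg-fourth (x< (fromℕ m)))))

      Dominated′ : Carrier → Set
      Dominated′ y = Dominated Fσ {h} ((σ * σ) * (σ * y))

      dominated-from-fourth : ∀ {y} → Bounded σ y → (y * y) * (y * y) ≼′ h → Dominated′ y
      dominated-from-fourth y< y⁴≼h = dominated-linear Fσ y<
        (dominated-root Fσ (Bounded-* y< y<) (≼⇒dominated Fσ y⁴≼h))

      dominated-sum : ∀ {y z} → Dominated′ y → Dominated′ z → Dominated′ (y + z)
      dominated-sum {y} {z} y-dom z-dom = dominated-resp Fσ
        (solve 3 (λ σ y z → (σ :* σ) :* (σ :* y) :+ (σ :* σ) :* (σ :* z) :=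
           (σ :* σ) :* (σ :* (y :+ z))) refl σ y z)
        (dominated-+ Fσ y-dom z-dom)

      -- xⱼ² = cⱼ + t xⱼ₊₁ ≤ cⱼ + σ xⱼ₊₁.
      dominated-step : ∀ j → Dominated′ (x (suc j)) → Dominated′ (x (inject₁ j))
      dominated-step j next = dominated-linear Fσ (x< (inject₁ j))
        (dominated-resp Fσ
          (trans (solve 4 (λ σ y² t z → (σ :* σ) :* (y² :- t :* z) :+ (σ :* σ) :* (t :* z)
                    := (σ :* σ) :* y²) refl σ (x (inject₁ j) ^ 2) t (x (suc j)))
                 (*-congˡ (^2≈ (x (inject₁ j)))))
          (dominated-+ Fσ
            (dominated-root Fσ (c< j) (≼⇒dominated Fσ (c≼h j)))
            (dominated-≼ Fσ
              (nonneg-F Fσ (ratio-resp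
                (solve 3 (λ σ t z → (σ :* σ) :* ((σ :- t) :* z) :=
                   (σ :* σ) :* (σ :* z) :- (σ :* σ) :* (t :* z)) refl σ t (x (suc j)))
                (ratio-* (ratio-* Fσ Fσ) (ratio-* ratio-σ-t (Fx (suc j))))))
              next)))

      dominated-x : ∀ j → Dominated′ (x j)
      dominated-x = >-weakInduction (λ j → Dominated′ (x j))
        (dominated-from-fourth (x< (fromℕ m)) xₙ≼h) dominated-step

      -- `b` carries domination from `x₂`, where the chain of links ends, over to `x₁`; in the same
      -- way `a` carries it from `x₁` to `t` in `dominated-t`.
      dominated-x₁ : Dominated′ x₁
      dominated-x₁ = dominated-resp Fσ
        (solve 3 (λ σ y z → (σ :* σ) :* (σ :* ((y :- :con (ℤ.+ 2) :* z) :+ (z :+ z))) :=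
           (σ :* σ) :* (σ :* y)) refl σ x₁ x₂)
        (dominated-sum (dominated-from-fourth b< b≼h)
          (dominated-sum (dominated-x zero) (dominated-x zero)))

      dominated-t : Dominated′ t
      dominated-t = dominated-resp Fσ
        (solve 3 (λ σ t y → (σ :* σ) :* (σ :* ((t :- y) :+ y)) := (σ :* σ) :* (σ :* t)) refl σ t x₁)
        (dominated-sum
          (dominated-from-fourth (Bounded-- t< x₁<)
            (≼-respˡ (solve 2 (λ t y →
               ((y :- t) :* (y :- t)) :* ((y :- t) :* (y :- t)) :=
               ((t :- y) :* (t :- y)) :* ((t :- y) :* (t :- y))) refl t x₁) a≼h))
          dominated-x₁)

      dominated-Σ : ∀ {k} (y : Fin k → Carrier) → (∀ j → Dominated′ (y j)) →
                    Dominated′ (foldr _+_ t y)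
      dominated-Σ {zero}  y y-dom = dominated-t
      dominated-Σ {suc k} y y-dom =
        dominated-sum (y-dom zero) (dominated-Σ (tail y) (λ j → y-dom (suc j)))

    ratio-quartic : Ratio⁺ h
    -- `Dominated′ σ` is by definition domination of σ⁴, and `σ` is the sum of the variables handled
    -- so far.
    ratio-quartic = dominated-σ⁴⇒F Fσ
      (dominated-sum dominated-t (dominated-sum dominated-x₁ (dominated-Σ x dominated-x)))

-- Evaluation of polynomials in a commutative ring

open P using (Poly; int; []; _∷_; con; var; coeff; coeff-+; Zero; coeff≡; _·_)

coeff-neg : ∀ {n} (p : Poly n) e → coeff (P.- p) e ≡ ℤ.- coeff p e
coeff-neg (int a) []          = ≡.refl
coeff-neg []      (_ ∷ _)     = ≡.refl
coeff-neg (a ∷ p) (zero ∷ e)  = coeff-neg a e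
coeff-neg (a ∷ p) (suc k ∷ e) = coeff-neg p (k ∷ e)

-- Equal polynomials may have different shapes because of trailing zeros, so a simultaneous
-- recursion on both is awkward. Congruence of evaluation and of products is reduced to a single
-- polynomial, the difference, all of whose coefficients vanish.
difference-Zero : ∀ {n} {p q : Poly n} → p P.≈ q → Zero (p P.- q)
difference-Zero {p = p} {q} p≈q e = ≡.trans (coeff-+ p (P.- q) e)
  (≡.trans (≡.cong₂ ℤ._+_ (coeff≡ p≈q e) (coeff-neg q e)) (ℤ.+-inverseʳ (coeff q e)))

module Evaluation {R : CommutativeRing 0ℓ 0ℓ} (ι : ℤ-Morphism R) where
  open CommutativeRing R hiding (zero)
  open RingProperties ring using (-0#≈0#) renaming (x∙y⁻¹≈ε⇒x≈y to x-y≈0⇒x≈y)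
  open ACR._-Raw-AlmostCommutative⟶_ ι
    using () renaming (⟦_⟧ to con′; +-homo to con′-+; *-homo to con′-*;
                       -‿homo to con′-neg; 0-homo to con′-0; 1-homo to con′-1)
  open ℤ-CoefficientSolver ι
  open SetoidReasoning setoid

  eval : ∀ {n} → (Fin n → Carrier) → Poly n → Carrier
  eval ρ (int a) = con′ a
  eval ρ []      = 0#
  eval ρ (a ∷ p) = eval (tail ρ) a + ρ zero * eval ρ p

  eval-0# : ∀ {n} (ρ : Fin n → Carrier) → eval ρ P.0# ≈ 0#
  eval-0# {zero}  ρ = con′-0
  eval-0# {suc n} ρ = refl

  eval-Zero : ∀ {n} (ρ : Fin n → Carrier) p → Zero p → eval ρ p ≈ 0#
  eval-Zero ρ (int a) z with z []
  ... | ≡.refl = con′-0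
  eval-Zero ρ []      z = refl
  eval-Zero ρ (a ∷ p) z = begin
    eval (tail ρ) a + ρ zero * eval ρ p
      ≈⟨ +-cong (eval-Zero (tail ρ) a (λ e → z (zero ∷ e)))
                (*-congˡ (eval-Zero ρ p λ { (k ∷ e) → z (suc k ∷ e) })) ⟩
    0# + ρ zero * 0#  ≈⟨ +-identityˡ _ ⟩
    ρ zero * 0#       ≈⟨ zeroʳ _ ⟩
    0#                ∎

  eval-+ : ∀ {n} (ρ : Fin n → Carrier) p q → eval ρ (p P.+ q) ≈ eval ρ p + eval ρ q
  eval-+ ρ (int a) (int b) = con′-+ a b
  eval-+ ρ []      q       = sym (+-identityˡ _)
  eval-+ ρ (a ∷ p) []      = sym (+-identityʳ _)
  eval-+ ρ (a ∷ p) (b ∷ q) = begin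
    eval (tail ρ) (a P.+ b) + ρ zero * eval ρ (p P.+ q)
      ≈⟨ +-cong (eval-+ (tail ρ) a b) (*-congˡ (eval-+ ρ p q)) ⟩
    (eval (tail ρ) a + eval (tail ρ) b) + ρ zero * (eval ρ p + eval ρ q)
      ≈⟨ solve 5 (λ a b x p q → (a :+ b) :+ x :* (p :+ q) :=
           (a :+ x :* p) :+ (b :+ x :* q)) refl _ _ _ _ _ ⟩
    (eval (tail ρ) a + ρ zero * eval ρ p) + (eval (tail ρ) b + ρ zero * eval ρ q) ∎

  eval-neg : ∀ {n} (ρ : Fin n → Carrier) p → eval ρ (P.- p) ≈ - eval ρ p
  eval-neg ρ (int a) = con′-neg a
  eval-neg ρ []      = sym -0#≈0#
  eval-neg ρ (a ∷ p) = begin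
    eval (tail ρ) (P.- a) + ρ zero * eval ρ (P.- p)
      ≈⟨ +-cong (eval-neg (tail ρ) a) (*-congˡ (eval-neg ρ p)) ⟩
    - eval (tail ρ) a + ρ zero * - eval ρ p
      ≈⟨ solve 3 (λ a x p → :- a :+ x :* (:- p) := :- (a :+ x :* p)) refl _ _ _ ⟩
    - (eval (tail ρ) a + ρ zero * eval ρ p) ∎

  eval-- : ∀ {n} (ρ : Fin n → Carrier) p q → eval ρ (p P.- q) ≈ eval ρ p - eval ρ q
  eval-- ρ p q = trans (eval-+ ρ p (P.- q)) (+-congˡ (eval-neg ρ q))

  eval-cong : ∀ {n} (ρ : Fin n → Carrier) {p q} → p P.≈ q → eval ρ p ≈ eval ρ q
  eval-cong ρ {p} {q} p≈q = x-y≈0⇒x≈y _ _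
    (trans (sym (eval-- ρ p q)) (eval-Zero ρ (p P.- q) (difference-Zero p≈q)))

  eval-* : ∀ {n} (ρ : Fin n → Carrier) p q → eval ρ (p P.* q) ≈ eval ρ p * eval ρ q
  eval-· : ∀ {n} (ρ : Fin (suc n) → Carrier) a q →
           eval ρ (a · q) ≈ eval (tail ρ) a * eval ρ q

  eval-* ρ (int a) (int b) = con′-* a b
  eval-* ρ []      q       = sym (zeroˡ _)
  eval-* ρ (a ∷ p) q       = begin
    eval ρ (a · q P.+ (P.0# ∷ p P.* q))
      ≈⟨ eval-+ ρ (a · q) (P.0# ∷ p P.* q) ⟩
    eval ρ (a · q) + (eval (tail ρ) P.0# + ρ zero * eval ρ (p P.* q))
      ≈⟨ +-cong (eval-· ρ a q) (+-cong (eval-0# (tail ρ)) (*-congˡ (eval-* ρ p q))) ⟩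
    eval (tail ρ) a * eval ρ q + (0# + ρ zero * (eval ρ p * eval ρ q))
      ≈⟨ +-congˡ (+-identityˡ _) ⟩
    eval (tail ρ) a * eval ρ q + ρ zero * (eval ρ p * eval ρ q)
      ≈⟨ solve 4 (λ a x p q → a :* q :+ x :* (p :* q) := (a :+ x :* p) :* q) refl _ _ _ _ ⟩
    (eval (tail ρ) a + ρ zero * eval ρ p) * eval ρ q ∎

  eval-· ρ a []      = sym (zeroʳ _)
  eval-· ρ a (b ∷ q) = begin
    eval (tail ρ) (a P.* b) + ρ zero * eval ρ (a · q)
      ≈⟨ +-cong (eval-* (tail ρ) a b) (*-congˡ (eval-· ρ a q)) ⟩
    eval (tail ρ) a * eval (tail ρ) b + ρ zero * (eval (tail ρ) a * eval ρ q)
      ≈⟨ solve 4 (λ a b x q → a :* b :+ x :* (a :* q) := a :* (b :+ x :* q)) refl _ _ _ _ ⟩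
    eval (tail ρ) a * (eval (tail ρ) b + ρ zero * eval ρ q) ∎

  eval-con : ∀ {n} (ρ : Fin n → Carrier) c → eval ρ (con c) ≈ con′ c
  eval-con {zero}  ρ c = refl
  eval-con {suc n} ρ c = begin
    eval (tail ρ) (con c) + ρ zero * 0#  ≈⟨ +-cong (eval-con (tail ρ) c) (zeroʳ _) ⟩
    con′ c + 0#                   ≈⟨ +-identityʳ _ ⟩
    con′ c                        ∎

  eval-1# : ∀ {n} (ρ : Fin n → Carrier) → eval ρ P.1# ≈ 1#
  eval-1# ρ = trans (eval-con ρ 1ℤ) con′-1

  eval-var : ∀ {n} (ρ : Fin n → Carrier) i → eval ρ (var i) ≈ ρ i
  eval-var ρ zero = begin
    eval (tail ρ) P.0# + ρ zero * eval ρ P.1#  ≈⟨ +-cong (eval-0# (tail ρ)) (*-congˡ (eval-1# ρ)) ⟩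
    0# + ρ zero * 1#                    ≈⟨ +-identityˡ _ ⟩
    ρ zero * 1#                         ≈⟨ *-identityʳ _ ⟩
    ρ zero                              ∎
  eval-var ρ (suc i) = begin
    eval (tail ρ) (var i) + ρ zero * 0#  ≈⟨ +-cong (eval-var (tail ρ) i) (zeroʳ _) ⟩
    ρ (suc i) + 0#                ≈⟨ +-identityʳ _ ⟩
    ρ (suc i)                     ∎

  module _ {n : ℕ} (ρ : Fin n → Carrier) where
    open RawSemiringDefinitions (RawRing.rawSemiring (P.polyRawRing n)) using (sum)
      renaming (_^_ to _^ᴾ_)
    open Exp semiring using (_^_)

    eval-^ : ∀ {p x} → eval ρ p ≈ x → ∀ k → eval ρ (p ^ᴾ k) ≈ x ^ k
    eval-^ eq zero = eval-1# ρ
    eval-^ {p} eq (suc k) = trans (eval-* ρ p (p ^ᴾ k)) (*-cong eq (eval-^ {p} eq k))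

    eval-sum : ∀ {m} (f : Fin m → Poly n) → (∀ i → eval ρ (f i) ≈ 0#) → eval ρ (sum f) ≈ 0#
    eval-sum {zero}  f f≈0 = eval-0# ρ
    eval-sum {suc m} f f≈0 = begin
      eval ρ (f zero P.+ sum (tail f))
        ≈⟨ eval-+ ρ (f zero) (sum (tail f)) ⟩
      eval ρ (f zero) + eval ρ (sum (tail f))
        ≈⟨ +-cong (f≈0 zero) (eval-sum (tail f) (λ i → f≈0 (suc i))) ⟩
      0# + 0#  ≈⟨ +-identityˡ 0# ⟩
      0#       ∎

    open Quartic (P.polyRawRing n) using (quartic)

    eval-quartic : ∀ {c₄ c₂ a b : Poly n} {m} {c : Fin m → Poly n} {x u v y z w} →
      eval ρ c₄ ≈ u → eval ρ c₂ ≈ v → eval ρ a ≈ y → eval ρ b ≈ z →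
      (∀ j → eval ρ (c j) ≈ 0#) → eval ρ x ≈ w →
      eval ρ (quartic c₄ c₂ a b c x) ≈
        y ^ 4 + z ^ 4 + 0# + u * y ^ 2 * w ^ 2 + v * w ^ 4
    eval-quartic {c₄} {c₂} {a} {b} {c = c} {x} 4≈ 2≈ a≈ b≈ c≈ x≈ =
      plus (a ^ᴾ 4 P.+ b ^ᴾ 4 P.+ sum (λ j → c j ^ᴾ 2) P.+ c₄ P.* a ^ᴾ 2 P.* x ^ᴾ 2) (c₂ P.* x ^ᴾ 4)
        (plus (a ^ᴾ 4 P.+ b ^ᴾ 4 P.+ sum (λ j → c j ^ᴾ 2)) (c₄ P.* a ^ᴾ 2 P.* x ^ᴾ 2)
          (plus (a ^ᴾ 4 P.+ b ^ᴾ 4) (sum (λ j → c j ^ᴾ 2))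
            (plus (a ^ᴾ 4) (b ^ᴾ 4) (eval-^ {a} a≈ 4) (eval-^ {b} b≈ 4))
            (eval-sum (λ j → c j ^ᴾ 2) (λ j → trans (eval-^ {c j} (c≈ j) 2) (zeroˡ _))))
          (times (c₄ P.* a ^ᴾ 2) (x ^ᴾ 2)
            (times c₄ (a ^ᴾ 2) 4≈ (eval-^ {a} a≈ 2)) (eval-^ {x} x≈ 2)))
        (times c₂ (x ^ᴾ 4) 2≈ (eval-^ {x} x≈ 4))
      where
      plus : ∀ p q {x y} → eval ρ p ≈ x → eval ρ q ≈ y → eval ρ (p P.+ q) ≈ x + y
      plus p q p≈ q≈ = trans (eval-+ ρ p q) (+-cong p≈ q≈)
      times : ∀ p q {x y} → eval ρ p ≈ x → eval ρ q ≈ y → eval ρ (p P.* q) ≈ x * y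
      times p q p≈ q≈ = trans (eval-* ρ p q) (*-cong p≈ q≈)

-- The commutative ring of polynomials

open import Defs
open ≡ using (refl; sym; trans; cong; cong₂; subst; subst₂; isEquivalence; module ≡-Reasoning)

≈-refl : ∀ {n} {p : Poly n} → p ≈ p
≈-refl = mk≈ λ e → refl

≈-sym : ∀ {n} {p q : Poly n} → p ≈ q → q ≈ p
≈-sym p≈q = mk≈ λ e → sym (coeff≡ p≈q e)

≈-trans : ∀ {n} {p q r : Poly n} → p ≈ q → q ≈ r → p ≈ r
≈-trans p≈q q≈r = mk≈ λ e → trans (coeff≡ p≈q e) (coeff≡ q≈r e)

polySetoid : ℕ → Setoid 0ℓ 0ℓ
polySetoid n = record
  { Carrier       = Poly n
  ; _≈_           = _≈_
  ; isEquivalence = record { refl = ≈-refl ; sym = ≈-sym ; trans = ≈-trans }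
  }

Zero⇒≈0# : ∀ {n} {p : Poly n} → Zero p → p ≈ 0#
Zero⇒≈0# z = mk≈ λ e → trans (z e) (sym (coeff-0# e))

∷-cong : ∀ {n} {a b : Poly n} {p q} → a ≈ b → p ≈ q → a ∷ p ≈ b ∷ q
∷-cong a≈b p≈q = mk≈ λ
  { (zero  ∷ e) → coeff≡ a≈b e
  ; (suc k ∷ e) → coeff≡ p≈q (k ∷ e)
  }

0∷[] : ∀ {n} → 0# {n} ∷ [] ≈ []
0∷[] = mk≈ λ { (zero ∷ e) → coeff-0# e ; (suc k ∷ e) → refl }

-- The additive group

+-cong : ∀ {n} {p p′ q q′ : Poly n} → p ≈ p′ → q ≈ q′ → p + q ≈ p′ + q′
+-cong {p = p} {p′} {q} {q′} p≈p′ q≈q′ = mk≈ λ e → trans (coeff-+ p q e)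
  (trans (cong₂ ℤ._+_ (coeff≡ p≈p′ e) (coeff≡ q≈q′ e)) (sym (coeff-+ p′ q′ e)))

+-assoc : ∀ {n} (p q r : Poly n) → (p + q) + r ≈ p + (q + r)
+-assoc p q r = mk≈ λ e → trans (coeff-+ (p + q) r e)
  (trans (cong (ℤ._+ coeff r e) (coeff-+ p q e))
  (trans (ℤ.+-assoc (coeff p e) _ _)
  (trans (cong (ℤ._+_ (coeff p e)) (sym (coeff-+ q r e)))
         (sym (coeff-+ p (q + r) e)))))

+-comm : ∀ {n} (p q : Poly n) → p + q ≈ q + p
+-comm p q = mk≈ λ e → trans (coeff-+ p q e)
  (trans (ℤ.+-comm (coeff p e) _) (sym (coeff-+ q p e)))

+-identityˡ : ∀ {n} (p : Poly n) → 0# + p ≈ p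
+-identityˡ p = mk≈ λ e → dropˡ 0# p e (coeff-0# e)

+-identityʳ : ∀ {n} (p : Poly n) → p + 0# ≈ p
+-identityʳ p = mk≈ λ e → dropʳ p 0# e (coeff-0# e)

-‿cong : ∀ {n} {p q : Poly n} → p ≈ q → - p ≈ - q
-‿cong {p = p} {q} p≈q = mk≈ λ e → trans (coeff-neg p e)
  (trans (cong ℤ.-_ (coeff≡ p≈q e)) (sym (coeff-neg q e)))

-‿inverseʳ : ∀ {n} (p : Poly n) → p - p ≈ 0#
-‿inverseʳ p = mk≈ λ e → trans (coeff-+ p (- p) e)
  (trans (cong (ℤ._+_ (coeff p e)) (coeff-neg p e))
  (trans (ℤ.+-inverseʳ (coeff p e)) (sym (coeff-0# e))))

-‿inverseˡ : ∀ {n} (p : Poly n) → - p + p ≈ 0#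
-‿inverseˡ p = ≈-trans (+-comm (- p) p) (-‿inverseʳ p)

+-0-commutativeMonoid : ℕ → CommutativeMonoid 0ℓ 0ℓ
+-0-commutativeMonoid n = record
  { Carrier = Poly n
  ; _≈_     = _≈_
  ; _∙_     = _+_
  ; ε       = 0#
  ; isCommutativeMonoid = record
    { isMonoid = record
      { isSemigroup = record
        { isMagma = record
          { isEquivalence = Setoid.isEquivalence (polySetoid n)
          ; ∙-cong        = +-cong
          }
        ; assoc = +-assoc
        }
      ; identity = +-identityˡ , +-identityʳ
      }
    ; comm = +-comm
    }
  }

module _ {n : ℕ} where
  open CommutativeSemigroupProperties
    (CommutativeMonoid.commutativeSemigroup (+-0-commutativeMonoid n)) public
    using () renaming (interchange to +-interchange; x∙yz≈y∙xz to +-swap)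

+-cancelʳ : ∀ {n} (p q r : Poly n) → p + r ≈ q + r → p ≈ q
+-cancelʳ {n} p q r eq = begin
  p               ≈⟨ +-identityʳ p ⟨
  p + 0#          ≈⟨ +-cong ≈-refl (-‿inverseʳ r) ⟨
  p + (r - r)     ≈⟨ +-assoc p r (- r) ⟨
  (p + r) - r     ≈⟨ +-cong eq ≈-refl ⟩
  (q + r) - r     ≈⟨ +-assoc q r (- r) ⟩
  q + (r - r)     ≈⟨ +-cong ≈-refl (-‿inverseʳ r) ⟩
  q + 0#          ≈⟨ +-identityʳ q ⟩
  q               ∎
  where open SetoidReasoning (polySetoid n)

-- Multiplication

0∷-+ : ∀ {n} (p q : Poly (suc n)) → 0# ∷ (p + q) ≈ (0# ∷ p) + (0# ∷ q)
0∷-+ p q = ∷-cong (≈-sym (+-identityˡ 0#)) ≈-refl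

*-distribʳ-+ : ∀ {n} (r p q : Poly n) → (p + q) * r ≈ p * r + q * r
·-distribʳ-+ : ∀ {n} (r : Poly (suc n)) a b → (a + b) · r ≈ a · r + b · r

*-distribʳ-+ (int c) (int a) (int b) =
  mk≈ λ { [] → ℤ.*-distribʳ-+ c a b }
*-distribʳ-+ r []      q       = ≈-refl
*-distribʳ-+ r (a ∷ p) []      = ≈-sym (+-identityʳ _)
*-distribʳ-+ {suc n} r (a ∷ p) (b ∷ q) = begin
  (a + b) · r + (0# ∷ (p + q) * r)
    ≈⟨ +-cong (·-distribʳ-+ r a b)
         (≈-trans (∷-cong ≈-refl (*-distribʳ-+ r p q)) (0∷-+ (p * r) (q * r))) ⟩
  (a · r + b · r) + ((0# ∷ p * r) + (0# ∷ q * r))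
    ≈⟨ +-interchange (a · r) (b · r) (0# ∷ p * r) (0# ∷ q * r) ⟩
  (a · r + (0# ∷ p * r)) + (b · r + (0# ∷ q * r)) ∎
  where open SetoidReasoning (polySetoid (suc n))

·-distribʳ-+ []      a b = ≈-refl
·-distribʳ-+ (c ∷ r) a b = ∷-cong (*-distribʳ-+ c a b) (·-distribʳ-+ r a b)

*-distribˡ-+ : ∀ {n} (p q r : Poly n) → p * (q + r) ≈ p * q + p * r
·-distribˡ-+ : ∀ {n} (a : Poly n) q r → a · (q + r) ≈ a · q + a · r

*-distribˡ-+ (int a) (int b) (int c) =
  mk≈ λ { [] → ℤ.*-distribˡ-+ a b c }
*-distribˡ-+ []      q r = ≈-refl
*-distribˡ-+ {suc n} (a ∷ p) q r = begin
  a · (q + r) + (0# ∷ p * (q + r))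
    ≈⟨ +-cong (·-distribˡ-+ a q r)
         (≈-trans (∷-cong ≈-refl (*-distribˡ-+ p q r)) (0∷-+ (p * q) (p * r))) ⟩
  (a · q + a · r) + ((0# ∷ p * q) + (0# ∷ p * r))
    ≈⟨ +-interchange (a · q) (a · r) (0# ∷ p * q) (0# ∷ p * r) ⟩
  (a · q + (0# ∷ p * q)) + (a · r + (0# ∷ p * r)) ∎
  where open SetoidReasoning (polySetoid (suc n))

·-distribˡ-+ a []      r       = ≈-refl
·-distribˡ-+ a (b ∷ q) []      = ≈-refl
·-distribˡ-+ a (b ∷ q) (c ∷ r) = ∷-cong (*-distribˡ-+ a b c) (·-distribˡ-+ a q r)

*-zeroʳ-≈ : ∀ {n} (p : Poly n) → p * 0# ≈ 0#
*-zeroʳ-≈ p = Zero⇒≈0# (*-zeroʳ p 0# coeff-0#)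

*-congʳ : ∀ {n} {p p′ : Poly n} q → p ≈ p′ → p * q ≈ p′ * q
*-congʳ {n} {p} {p′} q p≈p′ = +-cancelʳ (p * q) (p′ * q) (- p′ * q) (begin
  p * q + - p′ * q   ≈⟨ *-distribʳ-+ q p (- p′) ⟨
  (p - p′) * q       ≈⟨ Zero⇒≈0# (*-zeroˡ (p - p′) q (difference-Zero p≈p′)) ⟩
  0#                 ≈⟨ Zero⇒≈0# (*-zeroˡ (p′ - p′) q (difference-Zero (≈-refl {p = p′}))) ⟨
  (p′ - p′) * q      ≈⟨ *-distribʳ-+ q p′ (- p′) ⟩
  p′ * q + - p′ * q  ∎)
  where open SetoidReasoning (polySetoid n)

*-congˡ : ∀ {n} (p : Poly n) {q q′ : Poly n} → q ≈ q′ → p * q ≈ p * q′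
*-congˡ {n} p {q} {q′} q≈q′ = +-cancelʳ (p * q) (p * q′) (p * - q′) (begin
  p * q + p * - q′   ≈⟨ *-distribˡ-+ p q (- q′) ⟨
  p * (q - q′)       ≈⟨ Zero⇒≈0# (*-zeroʳ p (q - q′) (difference-Zero q≈q′)) ⟩
  0#                 ≈⟨ Zero⇒≈0# (*-zeroʳ p (q′ - q′) (difference-Zero (≈-refl {p = q′}))) ⟨
  p * (q′ - q′)      ≈⟨ *-distribˡ-+ p q′ (- q′) ⟩
  p * q′ + p * - q′  ∎)
  where open SetoidReasoning (polySetoid n)

*-cong : ∀ {n} {p p′ q q′ : Poly n} → p ≈ p′ → q ≈ q′ → p * q ≈ p′ * q′
*-cong {p′ = p′} {q} p≈p′ q≈q′ = ≈-trans (*-congʳ q p≈p′) (*-congˡ p′ q≈q′)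

*-comm : ∀ {n} (p q : Poly n) → p * q ≈ q * p
-- The defining clause of the product mirrored to the right argument, from which commutativity
-- follows by recursion. The `+ 0#` in `·-comm` is what the defining clause leaves in the constant
-- coefficient.
*-∷ʳ   : ∀ {n} (p : Poly (suc n)) b q → p * (b ∷ q) ≈ b · p + (0# ∷ p * q)
·-comm : ∀ {n} (a : Poly n) b → a * b + 0# ≈ b * a + 0#

*-comm (int a) (int b) = mk≈ λ { [] → ℤ.*-comm a b }
*-comm []      q       = ≈-sym (*-zeroʳ-≈ q)
*-comm (a ∷ p) q       =
  ≈-trans (+-cong ≈-refl (∷-cong ≈-refl (*-comm p q))) (≈-sym (*-∷ʳ q a p))

*-∷ʳ []      b q = ≈-sym 0∷[]
*-∷ʳ {n} (a ∷ p) b q = ∷-cong (·-comm a b) (begin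
  a · q + p * (b ∷ q)              ≈⟨ +-cong ≈-refl (*-∷ʳ p b q) ⟩
  a · q + (b · p + (0# ∷ p * q))   ≈⟨ +-swap (a · q) (b · p) (0# ∷ p * q) ⟩
  b · p + (a · q + (0# ∷ p * q))   ∎)
  where open SetoidReasoning (polySetoid (suc n))

·-comm a b = +-cong (*-comm a b) ≈-refl

0·-+ : ∀ {n} (q r : Poly (suc n)) → 0# · q + r ≈ r
0·-+ q r = mk≈ λ e → dropˡ (0# · q) r e (·-zeroˡ 0# q coeff-0# e)

*-assoc  : ∀ {n} (p q r : Poly n) → (p * q) * r ≈ p * (q * r)
·-*-assoc : ∀ {n} (a : Poly n) q r → (a · q) * r ≈ a · (q * r)
·-assoc  : ∀ {n} (a b : Poly n) r → (a * b) · r ≈ a · (b · r)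

*-assoc (int a) (int b) (int c) = mk≈ λ { [] → ℤ.*-assoc a b c }
*-assoc []      q r = ≈-refl
*-assoc {suc n} (a ∷ p) q r = begin
  (a · q + (0# ∷ p * q)) * r
    ≈⟨ *-distribʳ-+ r (a · q) (0# ∷ p * q) ⟩
  (a · q) * r + (0# · r + (0# ∷ (p * q) * r))
    ≈⟨ +-cong (·-*-assoc a q r)
         (≈-trans (0·-+ r (0# ∷ (p * q) * r)) (∷-cong ≈-refl (*-assoc p q r))) ⟩
  a · (q * r) + (0# ∷ p * (q * r)) ∎
  where open SetoidReasoning (polySetoid (suc n))

·-*-assoc a []      r = ≈-refl
·-*-assoc {n} a (b ∷ q) r = begin
  (a * b) · r + (0# ∷ (a · q) * r)
    ≈⟨ +-cong (·-assoc a b r)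
         (∷-cong (≈-sym (*-zeroʳ-≈ a)) (·-*-assoc a q r)) ⟩
  a · (b · r) + a · (0# ∷ q * r)
    ≈⟨ ·-distribˡ-+ a (b · r) (0# ∷ q * r) ⟨
  a · (b · r + (0# ∷ q * r)) ∎
  where open SetoidReasoning (polySetoid (suc n))

·-assoc a b []      = ≈-refl
·-assoc a b (c ∷ r) = ∷-cong (*-assoc a b c) (·-assoc a b r)

*-identityˡ : ∀ {n} (p : Poly n) → 1# * p ≈ p
1·-identity : ∀ {n} (p : Poly (suc n)) → 1# · p ≈ p

*-identityˡ (int a) = mk≈ λ { [] → ℤ.*-identityˡ a }
*-identityˡ {suc n} p = ≈-trans (+-cong (1·-identity p) 0∷[]) (+-identityʳ p)

1·-identity []      = ≈-refl
1·-identity (a ∷ p) = ∷-cong (*-identityˡ a) (1·-identity p)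

*-identityʳ : ∀ {n} (p : Poly n) → p * 1# ≈ p
*-identityʳ p = ≈-trans (*-comm p 1#) (*-identityˡ p)

polyRing : ℕ → CommutativeRing 0ℓ 0ℓ
polyRing n = record
  { Carrier = Poly n
  ; _≈_     = _≈_
  ; _+_     = _+_
  ; _*_     = _*_
  ; -_      = -_
  ; 0#      = 0#
  ; 1#      = 1#
  ; isCommutativeRing = record
    { isRing = record
      { +-isAbelianGroup = record
        { isGroup = record
          { isMonoid = CommutativeMonoid.isMonoid (+-0-commutativeMonoid n)
          ; inverse  = -‿inverseˡ , -‿inverseʳ
          ; ⁻¹-cong  = -‿cong
          }
        ; comm = +-comm
        }
      ; *-cong     = *-cong
      ; *-assoc    = *-assoc
      ; *-identity = *-identityˡ , *-identityʳ
      ; distrib    = *-distribˡ-+ , *-distribʳ-+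
      }
    ; *-comm = *-comm
    }
  }

con-+ : ∀ {n} a b → con {n} (a ℤ.+ b) ≈ con a + con b
con-+ {zero}  a b = ≈-refl
con-+ {suc n} a b = ∷-cong (con-+ a b) ≈-refl

con-* : ∀ {n} a b → con {n} (a ℤ.* b) ≈ con a * con b
con-* {zero}  a b = ≈-refl
con-* {suc n} a b =
  ∷-cong (≈-trans (con-* a b) (≈-sym (+-identityʳ (con a * con b)))) ≈-refl

con-neg : ∀ {n} a → con {n} (ℤ.- a) ≈ - con a
con-neg {zero}  a = ≈-refl
con-neg {suc n} a = ∷-cong (con-neg a) ≈-refl

con-0 : ∀ {n} → con {n} 0ℤ ≈ 0#
con-0 {zero}  = ≈-refl
con-0 {suc n} = ≈-trans (∷-cong con-0 ≈-refl) 0∷[]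

con-morphism : ∀ {n} → ℤ-Morphism (polyRing n)
con-morphism = record
  { ⟦_⟧    = con
  ; +-homo = con-+
  ; *-homo = con-*
  ; -‿homo = con-neg
  ; 0-homo = con-0
  ; 1-homo = ≈-refl
  }

-- Gaussian integers

record ℤ[i] : Set where
  constructor _+i_
  field
    re im : ℤ

open ℤ[i]

infix  5 _+i_

module _ where
  open ℤ-Solver.+-*-Solver using (solve; _:+_; _:*_; _:-_; _:=_) renaming (con to :con)

  infix  8 -ᵍ_
  infixl 7 _*ᵍ_
  infixl 6 _+ᵍ_

  _+ᵍ_ _*ᵍ_ : ℤ[i] → ℤ[i] → ℤ[i]
  (a +i b) +ᵍ (c +i d) = (a ℤ.+ c) +i (b ℤ.+ d)
  (a +i b) *ᵍ (c +i d) = (a ℤ.* c ℤ.- b ℤ.* d) +i (a ℤ.* d ℤ.+ b ℤ.* c)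

  -ᵍ_ : ℤ[i] → ℤ[i]
  -ᵍ (a +i b) = (ℤ.- a) +i (ℤ.- b)

  fromℤ : ℤ → ℤ[i]
  fromℤ a = a +i 0ℤ

  *ᵍ-comm : ∀ x y → x *ᵍ y ≡ y *ᵍ x
  *ᵍ-comm (a +i b) (c +i d) = cong₂ _+i_
    (solve 4 (λ a b c d → a :* c :- b :* d := c :* a :- d :* b) refl a b c d)
    (solve 4 (λ a b c d → a :* d :+ b :* c := c :* b :+ d :* a) refl a b c d)

  *ᵍ-assoc : ∀ x y z → (x *ᵍ y) *ᵍ z ≡ x *ᵍ (y *ᵍ z)
  *ᵍ-assoc (a +i b) (c +i d) (e +i f) = cong₂ _+i_
    (solve 6 (λ a b c d e f →
      (a :* c :- b :* d) :* e :- (a :* d :+ b :* c) :* f :=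
      a :* (c :* e :- d :* f) :- b :* (c :* f :+ d :* e)) refl a b c d e f)
    (solve 6 (λ a b c d e f →
      (a :* c :- b :* d) :* f :+ (a :* d :+ b :* c) :* e :=
      a :* (c :* f :+ d :* e) :+ b :* (c :* e :- d :* f)) refl a b c d e f)

  *ᵍ-distribˡ : ∀ x y z → x *ᵍ (y +ᵍ z) ≡ (x *ᵍ y) +ᵍ (x *ᵍ z)
  *ᵍ-distribˡ (a +i b) (c +i d) (e +i f) = cong₂ _+i_
    (solve 6 (λ a b c d e f →
      a :* (c :+ e) :- b :* (d :+ f) := (a :* c :- b :* d) :+ (a :* e :- b :* f))
      refl a b c d e f)
    (solve 6 (λ a b c d e f →
      a :* (d :+ f) :+ b :* (c :+ e) := (a :* d :+ b :* c) :+ (a :* f :+ b :* e))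
      refl a b c d e f)

  *ᵍ-distribʳ : ∀ x y z → (y +ᵍ z) *ᵍ x ≡ (y *ᵍ x) +ᵍ (z *ᵍ x)
  *ᵍ-distribʳ x y z = trans (*ᵍ-comm (y +ᵍ z) x)
    (trans (*ᵍ-distribˡ x y z) (cong₂ _+ᵍ_ (*ᵍ-comm x y) (*ᵍ-comm x z)))

  *ᵍ-identityˡ : ∀ x → fromℤ 1ℤ *ᵍ x ≡ x
  *ᵍ-identityˡ (a +i b) = cong₂ _+i_
    (solve 2 (λ a b → :con 1ℤ :* a :- :con 0ℤ :* b := a) refl a b)
    (solve 2 (λ a b → :con 1ℤ :* b :+ :con 0ℤ :* a := b) refl a b)

  fromℤ-* : ∀ a b → fromℤ (a ℤ.* b) ≡ fromℤ a *ᵍ fromℤ b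
  fromℤ-* a b = cong₂ _+i_
    (solve 2 (λ a b → a :* b := a :* b :- :con 0ℤ :* :con 0ℤ) refl a b)
    (solve 2 (λ a b → :con 0ℤ := a :* :con 0ℤ :+ :con 0ℤ :* b) refl a b)

ℤ[i]-ring : CommutativeRing 0ℓ 0ℓ
ℤ[i]-ring = record
  { Carrier = ℤ[i]
  ; _≈_     = _≡_
  ; _+_     = _+ᵍ_
  ; _*_     = _*ᵍ_
  ; -_      = -ᵍ_
  ; 0#      = fromℤ 0ℤ
  ; 1#      = fromℤ 1ℤ
  ; isCommutativeRing = record
    { isRing = record
      { +-isAbelianGroup = record
        { isGroup = record
          { isMonoid = record
            { isSemigroup = record
              { isMagma = record { isEquivalence = isEquivalence ; ∙-cong = cong₂ _+ᵍ_ }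
              ; assoc   = λ x y z → cong₂ _+i_ (ℤ.+-assoc (re x) (re y) (re z))
                                               (ℤ.+-assoc (im x) (im y) (im z))
              }
            ; identity = (λ x → cong₂ _+i_ (ℤ.+-identityˡ (re x)) (ℤ.+-identityˡ (im x)))
                       , (λ x → cong₂ _+i_ (ℤ.+-identityʳ (re x)) (ℤ.+-identityʳ (im x)))
            }
          ; inverse = (λ x → cong₂ _+i_ (ℤ.+-inverseˡ (re x)) (ℤ.+-inverseˡ (im x)))
                    , (λ x → cong₂ _+i_ (ℤ.+-inverseʳ (re x)) (ℤ.+-inverseʳ (im x)))
          ; ⁻¹-cong = cong -ᵍ_
          }
        ; comm = λ x y → cong₂ _+i_ (ℤ.+-comm (re x) (re y)) (ℤ.+-comm (im x) (im y))
        }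
      ; *-cong     = cong₂ _*ᵍ_
      ; *-assoc    = *ᵍ-assoc
      ; *-identity = *ᵍ-identityˡ
                   , λ x → trans (*ᵍ-comm x (fromℤ 1ℤ)) (*ᵍ-identityˡ x)
      ; distrib    = *ᵍ-distribˡ , *ᵍ-distribʳ
      }
    ; *-comm = *ᵍ-comm
    }
  }

fromℤ-morphism : ℤ-Morphism ℤ[i]-ring
fromℤ-morphism = record
  { ⟦_⟧    = fromℤ
  ; +-homo = λ a b → refl
  ; *-homo = fromℤ-*
  ; -‿homo = λ a → refl
  ; 0-homo = refl
  ; 1-homo = refl
  }

open CommutativeRing ℤ[i]-ring public
  using () renaming (_-_ to _-ᵍ_; *-identityʳ to *ᵍ-identityʳ)
open Exp (CommutativeRing.semiring ℤ[i]-ring) public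
  using () renaming (_^_ to _^ᵍ_; ^-homo-* to ^ᵍ-homo-*)

-- Integer inequalities and the argument of powers of N + i

0≤+ : ∀ {a b} → 0ℤ ℤ.≤ a → 0ℤ ℤ.≤ b → 0ℤ ℤ.≤ a ℤ.+ b
0≤+ = ℤ.+-mono-≤

0≤* : ∀ {a b} → 0ℤ ℤ.≤ a → 0ℤ ℤ.≤ b → 0ℤ ℤ.≤ a ℤ.* b
0≤* {ℤ.+ m} {ℤ.+ n} _ _ = subst (0ℤ ℤ.≤_) (ℤ.pos-* m n) (+≤+ z≤n)

0<* : ∀ {a b} → 0ℤ ℤ.< a → 0ℤ ℤ.< b → 0ℤ ℤ.< a ℤ.* b
0<* (+<+ (s≤s _)) (+<+ (s≤s _)) = +<+ (s≤s z≤n)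

0<-cancel : ∀ n {a} → 0ℤ ℤ.< ℤ.+ suc n ℤ.* a → 0ℤ ℤ.< a
0<-cancel n {a} p = ℤ.*-cancelˡ-<-nonNeg (ℤ.+ suc n)
  (subst (ℤ._< ℤ.+ suc n ℤ.* a) (sym (ℤ.*-zeroʳ (ℤ.+ suc n))) p)

0≤-cancel : ∀ n {a} → 0ℤ ℤ.≤ ℤ.+ suc n ℤ.* a → 0ℤ ℤ.≤ a
0≤-cancel n {a} p = ℤ.*-cancelˡ-≤-pos _ _ (ℤ.+ suc n)
  (subst (ℤ._≤ ℤ.+ suc n ℤ.* a) (sym (ℤ.*-zeroʳ (ℤ.+ suc n))) p)

0≤ : ∀ n → 0ℤ ℤ.≤ ℤ.+ n
0≤ n = +≤+ z≤n

module _ (N : ℕ) where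

  private
    w : ℤ[i]
    w = ℤ.+ N +i 1ℤ

  -- tan (arg wᵏ) ≤ k / (l + 1).
  power-slope : ∀ k l → N ≡ k ℕ.+ l →
    0ℤ ℤ.< re (w ^ᵍ k) × 0ℤ ℤ.≤ ℤ.+ k ℤ.* re (w ^ᵍ k) ℤ.- (1ℤ ℤ.+ ℤ.+ l) ℤ.* im (w ^ᵍ k)
  power-slope zero    l eq = +<+ (s≤s z≤n) ,
    subst (0ℤ ℤ.≤_)
      (solve 1 (λ l → :con 0ℤ := :con 0ℤ :* :con 1ℤ :- (:con 1ℤ :+ l) :* :con 0ℤ) refl (ℤ.+ l))
      (0≤ 0)
    where open ℤ-Solver.+-*-Solver using (solve; _:+_; _:*_; _:-_; _:=_) renaming (con to :con)
  power-slope (suc k) l eq = c′>0 , D′≥0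
    where
    open ℤ-Solver.+-*-Solver using (solve; _:+_; _:*_; _:-_; _:=_) renaming (con to :con)
    K L c s N′ D : ℤ
    K  = ℤ.+ k
    L  = ℤ.+ l
    c  = re (w ^ᵍ k)
    s  = im (w ^ᵍ k)
    N′ = 1ℤ ℤ.+ (K ℤ.+ L)
    D  = K ℤ.* c ℤ.- (1ℤ ℤ.+ (1ℤ ℤ.+ L)) ℤ.* s

    -- `l` grows as `k` shrinks, keeping `N` fixed: the bound is k / (N + 1 - k). It survives the
    -- tangent addition formula with tan (arg w) = 1/N and is still finite at k = N, so the real
    -- part never reaches 0.
    ih = power-slope k (suc l) (trans eq (sym (ℕ.+-suc k l)))

    c>0 : 0ℤ ℤ.< c
    c>0 = proj₁ ih

    D≥0 : 0ℤ ℤ.≤ D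
    D≥0 = proj₂ ih

    N≡N′ : ℤ.+ N ≡ N′
    N≡N′ = cong ℤ.+_ eq

    c′>0 : 0ℤ ℤ.< re (w ^ᵍ suc k)
    -- Both claims are multiplied by l + 2, so that (l + 2) s can be replaced by k c - D. What
    -- results is a combination of D and c with nonnegative coefficients.
    c′>0 = 0<-cancel (suc l)
      (subst (0ℤ ℤ.<_)
        (trans (solve 4 (λ K L c s →
          (K :* c :- (:con 1ℤ :+ (:con 1ℤ :+ L)) :* s)
          :+ c :* ((:con 1ℤ :+ (:con 1ℤ :+ L)) :* (:con 1ℤ :+ L) :+ (:con 1ℤ :+ L) :* K)
          := (:con 1ℤ :+ (:con 1ℤ :+ L)) :* ((:con 1ℤ :+ (K :+ L)) :* c :- :con 1ℤ :* s))
          refl K L c s)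
          (cong (λ M → (1ℤ ℤ.+ (1ℤ ℤ.+ L)) ℤ.* (M ℤ.* c ℤ.- 1ℤ ℤ.* s)) (sym N≡N′)))
        (ℤ.+-mono-≤-< D≥0 (0<* c>0 (ℤ.+-mono-<-≤
          (0<* {ℤ.+ suc (suc l)} {ℤ.+ suc l} (+<+ (s≤s z≤n)) (+<+ (s≤s z≤n)))
          (0≤* (0≤ (suc l)) (0≤ k))))))

    D′≥0 : 0ℤ ℤ.≤ ℤ.+ suc k ℤ.* re (w ^ᵍ suc k) ℤ.- (1ℤ ℤ.+ L) ℤ.* im (w ^ᵍ suc k)
    D′≥0 = 0≤-cancel (suc l)
      (subst (0ℤ ℤ.≤_)
        (trans (solve 4 (λ K L c s →
          (K :* c :- (:con 1ℤ :+ (:con 1ℤ :+ L)) :* s)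
          :* ((:con 1ℤ :+ K) :+ (:con 1ℤ :+ L) :* (:con 1ℤ :+ (K :+ L)))
          :+ c :* (K :* ((:con 1ℤ :+ L) :+ (:con 1ℤ :+ L)))
          := (:con 1ℤ :+ (:con 1ℤ :+ L)) :*
             ((:con 1ℤ :+ K) :* ((:con 1ℤ :+ (K :+ L)) :* c :- :con 1ℤ :* s)
             :- (:con 1ℤ :+ L) :* ((:con 1ℤ :+ (K :+ L)) :* s :+ :con 1ℤ :* c)))
          refl K L c s)
          (cong (λ M → (1ℤ ℤ.+ (1ℤ ℤ.+ L)) ℤ.* ((1ℤ ℤ.+ K) ℤ.* (M ℤ.* c ℤ.- 1ℤ ℤ.* s)
                         ℤ.- (1ℤ ℤ.+ L) ℤ.* (M ℤ.* s ℤ.+ 1ℤ ℤ.* c))) (sym N≡N′)))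
        (0≤+ (0≤* D≥0 (0≤+ (0≤ (suc k)) (0≤* (0≤ (suc l)) (0≤ (suc (k ℕ.+ l))))))
             (0≤* (ℤ.<⇒≤ c>0) (0≤* (0≤ k) (0≤+ (0≤ (suc l)) (0≤ (suc l)))))))

  re-power>0 : ∀ {k} → k ℕ.≤ N → 0ℤ ℤ.< re (w ^ᵍ k)
  re-power>0 {k} k≤N = proj₁ (power-slope k (N ℕ.∸ k) (sym (ℕ.m+[n∸m]≡n k≤N)))

-- Values of subtraction-free circuits

-- These are the values at x₁ = w of nonzero polynomials in x₁ of degree at most `d` with natural
-- coefficients; a coefficient is a repeated summand. Coordinates that are positive integers are
-- multiples of w⁰ and so do not raise the degree.
data Cone (w : ℤ[i]) (d : ℕ) : ℤ[i] → Set where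
  power : ∀ {k} → k ℕ.≤ d → Cone w d (w ^ᵍ k)
  _⊕_   : ∀ {x y} → Cone w d x → Cone w d y → Cone w d (x +ᵍ y)

module _ {w : ℤ[i]} where

  cone-mono : ∀ {d e x} → d ℕ.≤ e → Cone w d x → Cone w e x
  cone-mono d≤e (power k≤d) = power (ℕ.≤-trans k≤d d≤e)
  cone-mono d≤e (x∈ ⊕ y∈)   = cone-mono d≤e x∈ ⊕ cone-mono d≤e y∈

  cone-* : ∀ {d e x y} → Cone w d x → Cone w e y → Cone w (d ℕ.+ e) (x *ᵍ y)
  cone-* {d} {e} (power {k} k≤d) (power {l} l≤e) =
    subst (Cone w (d ℕ.+ e)) (^ᵍ-homo-* w k l) (power (ℕ.+-mono-≤ k≤d l≤e))
  cone-* {d} {e} {x} x∈ (_⊕_ {y} {z} y∈ z∈) =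
    subst (Cone w (d ℕ.+ e)) (sym (*ᵍ-distribˡ x y z)) (cone-* x∈ y∈ ⊕ cone-* x∈ z∈)
  cone-* {d} {e} {y = z} (_⊕_ {x} {y} x∈ y∈) z∈@(power _) =
    subst (Cone w (d ℕ.+ e)) (sym (*ᵍ-distribʳ z x y)) (cone-* x∈ z∈ ⊕ cone-* y∈ z∈)

  cone-ℕ : ∀ {d} n .{{_ : ℕ.NonZero n}} → Cone w d (fromℤ (ℤ.+ n))
  cone-ℕ (suc zero)    = power z≤n
  cone-ℕ (suc (suc n)) = power z≤n ⊕ cone-ℕ (suc n)

cone⇒re>0 : ∀ {w d x} → (∀ {k} → k ℕ.≤ d → 0ℤ ℤ.< re (w ^ᵍ k)) → Cone w d x → 0ℤ ℤ.< re x
cone⇒re>0 pos (power k≤d) = pos k≤d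
cone⇒re>0 pos (x∈ ⊕ y∈)   = ℤ.+-mono-< (cone⇒re>0 pos x∈) (cone⇒re>0 pos y∈)

open Evaluation {ℤ[i]-ring} fromℤ-morphism

module _ {n : ℕ} {w : ℤ[i]} (ρ : Fin n → ℤ[i]) where

  -- Numerator and denominator are taken uncancelled, as the gates leave them, since cancelling
  -- could destroy positivity of the coefficients. They share one bound because addition and
  -- division multiply numerators by denominators.
  record ConeRatio (d : ℕ) (f : RatFun n) : Set where
    constructor coneRatio
    field
      num∈ : Cone w d (eval ρ (num f))
      den∈ : Cone w d (eval ρ (den f))

  cone-eval-+ : ∀ {d} p q → Cone w d (eval ρ p) → Cone w d (eval ρ q) → Cone w d (eval ρ (p + q))
  cone-eval-+ {d} p q p∈ q∈ = subst (Cone w d) (sym (eval-+ ρ p q)) (p∈ ⊕ q∈)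

  cone-eval-* : ∀ {d e} p q → Cone w d (eval ρ p) → Cone w e (eval ρ q) →
                Cone w (d ℕ.+ e) (eval ρ (p * q))
  cone-eval-* {d} {e} p q p∈ q∈ = subst (Cone w (d ℕ.+ e)) (sym (eval-* ρ p q)) (cone-* p∈ q∈)

  cone-eval-con : ∀ {d} k .{{_ : ℕ.NonZero k}} → Cone w d (eval ρ (con (ℤ.+ k)))
  cone-eval-con {d} k = subst (Cone w d) (sym (eval-con ρ (ℤ.+ k))) (cone-ℕ k)

  cone-apply : ∀ {op d f g h} → Apply op f g h → ¬ (op ≡ sub) →
               ConeRatio d f → ConeRatio d g → ConeRatio (d ℕ.+ d) h
  cone-apply {f = f} {g} add op≢sub (coneRatio a b) (coneRatio c d) = coneRatio
    (cone-eval-+ (num f * den g) (num g * den f)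
      (cone-eval-* (num f) (den g) a d) (cone-eval-* (num g) (den f) c b))
    (cone-eval-* (den f) (den g) b d)
  cone-apply sub op≢sub _ _ = contradiction refl op≢sub
  cone-apply {f = f} {g} mul op≢sub (coneRatio a b) (coneRatio c d) =
    coneRatio (cone-eval-* (num f) (num g) a c) (cone-eval-* (den f) (den g) b d)
  cone-apply {f = f} {g} (div _) op≢sub (coneRatio a b) (coneRatio c d) =
    coneRatio (cone-eval-* (num f) (den g) a d) (cone-eval-* (den f) (num g) b c)

  module _ (ρ∈ : ∀ i → Cone w 1 (ρ i)) where

    cone-value : ∀ {m d} {vs : Vec (RatFun n) m} → 1 ℕ.≤ d → (∀ j → ConeRatio d (lookup vs j)) →
                 ∀ a → ConeRatio d (value vs a)
    cone-value {d = d} 1≤d vs∈ (input i) = coneRatio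
      (subst (Cone w d) (sym (eval-var ρ i)) (cone-mono 1≤d (ρ∈ i))) (cone-eval-con 1)
    cone-value 1≤d vs∈ (scalar c) = coneRatio (cone-eval-con c) (cone-eval-con 1)
    cone-value 1≤d vs∈ (gate j)   = vs∈ j

    cone-values : ∀ {s} {gs : Gates n s} {vs} → NoSub gs → Values gs vs →
                  ∀ a → ConeRatio (2 ℕ.^ s) (value vs a)
    cone-values {s} noSub vals = cone-value (ℕ.m^n>0 2 s) (gates∈ noSub vals)
      where
      gates∈ : ∀ {s} {gs : Gates n s} {vs} → NoSub gs → Values gs vs →
               ∀ j → ConeRatio (2 ℕ.^ s) (lookup vs j)
      gates∈ {suc s} (noSub ▷ op≢sub) (_▷_ {a = a} {b} vals app) = λ
        { zero    → mono (ℕ.+-monoʳ-≤ (2 ℕ.^ s) (ℕ.m≤m+n (2 ℕ.^ s) 0))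
                      (cone-apply app op≢sub (cone-values noSub vals a) (cone-values noSub vals b))
        ; (suc j) → mono (ℕ.m≤m+n (2 ℕ.^ s) _) (gates∈ noSub vals j)
        }
        where
        mono : ∀ {d e f} → d ℕ.≤ e → ConeRatio d f → ConeRatio e f
        mono d≤e (coneRatio a b) = coneRatio (cone-mono d≤e a) (cone-mono d≤e b)

    -- If the output is num / den, the equation num · 1 = p · den forces num to vanish at the point
    -- whatever the value of den. A cone element of degree at most N cannot vanish there, having
    -- positive real part.
    vanishing⇒large : ∀ {N p} → (∀ {k} → k ℕ.≤ N → 0ℤ ℤ.< ℤ[i].re (w ^ᵍ k)) →
                      eval ρ p ≡ fromℤ 0ℤ →
                      (c : Circuit n) → SubtractionFree c → Computes c (fromPoly p) →
                      N ℕ.< 2 ℕ.^ size c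
    vanishing⇒large {N} {p} pos p≡0 c noSub (vs , vals , mk≃ eq) = ℕ.≰⇒> λ 2^s≤N →
      ℤ.<-irrefl (sym (cong ℤ[i].re num≡0))
        (cone⇒re>0 (λ k≤ → pos (ℕ.≤-trans k≤ 2^s≤N)) (ConeRatio.num∈ out∈))
      where
      out = value vs (output c)
      out∈ = cone-values noSub vals (output c)

      open ≡-Reasoning
      num≡0 : eval ρ (num out) ≡ fromℤ 0ℤ
      num≡0 = begin
        eval ρ (num out)               ≡⟨ eval-cong ρ (*-identityʳ (num out)) ⟨
        eval ρ (num out * 1#)          ≡⟨ eval-cong ρ eq ⟩
        eval ρ (p * den out)           ≡⟨ eval-* ρ p (den out) ⟩
        eval ρ p *ᵍ eval ρ (den out)   ≡⟨ cong (_*ᵍ eval ρ (den out)) p≡0 ⟩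
        fromℤ 0ℤ *ᵍ eval ρ (den out)   ≡⟨ refl ⟩
        fromℤ 0ℤ                       ∎

-- A Gaussian zero of Hₙ and the lower bound

module _ (m : ℕ) where
  private
    M N : ℕ
    M = 2 ℕ.^ m
    N = 2 ℕ.^ M

    w : ℤ[i]
    w = ℤ.+ N +i 1ℤ

  -- The truncated subtraction is exact, since `toℕ j ≤ m` gives 2^j ≤ M. The ends are j = 0, where
  -- x₂ = N / 2, and j = m, where xₙ = 1.
  nearRoot : Fin (3 ℕ.+ m) → ℤ[i]
  nearRoot zero          = fromℤ (ℤ.+ N)
  nearRoot (suc zero)    = w
  nearRoot (suc (suc j)) = fromℤ (ℤ.+ (2 ℕ.^ (M ∸ 2 ℕ.^ toℕ j)))

  nearRoot∈cone : ∀ i → Cone w 1 (nearRoot i)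
  nearRoot∈cone zero          = cone-ℕ N {{ℕ.m^n≢0 2 M}}
  nearRoot∈cone (suc zero)    = subst (Cone w 1) (*ᵍ-identityʳ w) (power (s≤s z≤n))
  nearRoot∈cone (suc (suc j)) = cone-ℕ _ {{ℕ.m^n≢0 2 (M ∸ 2 ℕ.^ toℕ j)}}

  open RawSemiringDefinitions (RawRing.rawSemiring (polyRawRing (3 ℕ.+ m))) using (_^_)

  private
    ρ = nearRoot
    t x₁ x₂ xₙ : Poly (3 ℕ.+ m)
    t  = var zero
    x₁ = var (suc zero)
    x₂ = var (suc (suc zero))
    xₙ = var (fromℕ (2 ℕ.+ m))

    i : ℤ[i]
    i = 0ℤ +i 1ℤ

    eval-var-- : ∀ p j {x y} → eval ρ p ≡ x → ρ j ≡ y → eval ρ (p - var j) ≡ x -ᵍ y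
    eval-var-- p j px jy =
      trans (eval-- ρ p (var j)) (cong₂ _-ᵍ_ px (trans (eval-var ρ j) jy))

    w-N : w -ᵍ fromℤ (ℤ.+ N) ≡ i
    w-N = cong (_+i 1ℤ) (ℤ.+-inverseʳ (ℤ.+ N))

    1≤M : 1 ℕ.≤ M
    1≤M = ℕ.m^n>0 2 m

    fromℕ-* : ∀ a b → fromℤ (ℤ.+ a) *ᵍ fromℤ (ℤ.+ b) ≡ fromℤ (ℤ.+ (a ℕ.* b))
    fromℕ-* a b = trans (sym (fromℤ-* (ℤ.+ a) (ℤ.+ b))) (cong fromℤ (sym (ℤ.pos-* a b)))

    x₁-t : eval ρ (x₁ - t) ≡ i
    x₁-t = trans (eval-var-- x₁ zero (eval-var ρ (suc zero)) refl) w-N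

    2x₂ : eval ρ (con (ℤ.+ 2) * x₂) ≡ fromℤ (ℤ.+ N)
    2x₂ = trans (eval-* ρ (con (ℤ.+ 2)) x₂)
      (trans (cong₂ _*ᵍ_ (eval-con ρ (ℤ.+ 2)) (eval-var ρ (suc (suc zero))))
      (trans (fromℕ-* 2 (2 ℕ.^ (M ∸ 1)))
        (cong (λ e → fromℤ (ℤ.+ (2 ℕ.^ e))) (ℕ.m+[n∸m]≡n 1≤M))))

    x₁-2x₂ : eval ρ (x₁ - con (ℤ.+ 2) * x₂) ≡ i
    x₁-2x₂ = trans (eval-- ρ x₁ (con (ℤ.+ 2) * x₂))
      (trans (cong₂ _-ᵍ_ (eval-var ρ (suc zero)) 2x₂) w-N)

    -- The link xᵢ² = t xᵢ₊₁ read off in exponents of 2, with xᵢ = 2^(M - a) and t = 2^M.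
    exponents : ∀ a → 2 ℕ.* a ℕ.≤ M → (M ∸ a) ℕ.+ (M ∸ a) ≡ M ℕ.+ (M ∸ 2 ℕ.* a)
    exponents a 2a≤M = begin
      (M ∸ a) ℕ.+ (M ∸ a)           ≡⟨ cong (λ k → k ℕ.+ k) M∸a ⟩
      (a ℕ.+ r) ℕ.+ (a ℕ.+ r)       ≡⟨ solve 2 (λ a r → (a :+ r) :+ (a :+ r) :=
                                         (:con 2 :* a :+ r) :+ r) refl a r ⟩
      (2 ℕ.* a ℕ.+ r) ℕ.+ r         ≡⟨ cong (ℕ._+ r) (ℕ.m+[n∸m]≡n 2a≤M) ⟩
      M ℕ.+ r                       ∎
      where

      open ≡-Reasoning
      open ℕ-Solver.+-*-Solver using (solve; _:+_; _:*_; _:=_) renaming (con to :con)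
      r = M ∸ 2 ℕ.* a
      M∸a : M ∸ a ≡ a ℕ.+ r
      M∸a = begin
        M ∸ a                      ≡⟨ cong (_∸ a) (ℕ.m+[n∸m]≡n 2a≤M) ⟨
        (2 ℕ.* a ℕ.+ r) ∸ a        ≡⟨ cong (_∸ a) (solve 2 (λ a r → :con 2 :* a :+ r :=
                                        a :+ (a :+ r)) refl a r) ⟩
        (a ℕ.+ (a ℕ.+ r)) ∸ a      ≡⟨ ℕ.m+n∸m≡n a (a ℕ.+ r) ⟩
        a ℕ.+ r                    ∎

    link : Fin m → Poly (3 ℕ.+ m)
    link j = var (suc (suc (inject₁ j))) ^ 2 - t * var (suc (suc (suc j)))

    link-vanishes : ∀ j → eval ρ (link j) ≡ fromℤ 0ℤ
    link-vanishes j = begin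
      eval ρ (link j)
        ≡⟨ eval-- ρ (xⱼ ^ 2) (t * xⱼ₊₁) ⟩
      eval ρ (xⱼ ^ 2) -ᵍ eval ρ (t * xⱼ₊₁)
        ≡⟨ cong₂ _-ᵍ_
             (trans (eval-^ ρ {xⱼ} (trans (eval-var ρ (suc (suc (inject₁ j))))
                      (cong (λ k → fromℤ (ℤ.+ (2 ℕ.^ (M ∸ 2 ℕ.^ k)))) (Fin.toℕ-inject₁ j))) 2)
             (trans (cong (y *ᵍ_) (*ᵍ-identityʳ y)) (fromℕ-* Y Y)))
             (trans (eval-* ρ t xⱼ₊₁) (trans (cong₂ _*ᵍ_ (eval-var ρ zero)
                      (eval-var ρ (suc (suc (suc j))))) (fromℕ-* N Z))) ⟩
      fromℤ (ℤ.+ (Y ℕ.* Y)) -ᵍ fromℤ (ℤ.+ (N ℕ.* Z))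
        ≡⟨ cong (λ k → fromℤ (ℤ.+ k) -ᵍ fromℤ (ℤ.+ (N ℕ.* Z))) Y²≡NZ ⟩
      fromℤ (ℤ.+ (N ℕ.* Z)) -ᵍ fromℤ (ℤ.+ (N ℕ.* Z))
        ≡⟨ cong fromℤ (ℤ.+-inverseʳ (ℤ.+ (N ℕ.* Z))) ⟩
      fromℤ 0ℤ ∎
      where

      open ≡-Reasoning
      xⱼ xⱼ₊₁ : Poly (3 ℕ.+ m)
      xⱼ   = var (suc (suc (inject₁ j)))
      xⱼ₊₁ = var (suc (suc (suc j)))
      Y Z : ℕ
      Y = 2 ℕ.^ (M ∸ 2 ℕ.^ toℕ j)
      Z = 2 ℕ.^ (M ∸ 2 ℕ.^ suc (toℕ j))
      y : ℤ[i]
      y = fromℤ (ℤ.+ Y)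
      Y²≡NZ : Y ℕ.* Y ≡ N ℕ.* Z
      Y²≡NZ = begin
        Y ℕ.* Y  ≡⟨ ℕ.^-distribˡ-+-* 2 (M ∸ 2 ℕ.^ toℕ j) _ ⟨
        2 ℕ.^ ((M ∸ 2 ℕ.^ toℕ j) ℕ.+ (M ∸ 2 ℕ.^ toℕ j))
          ≡⟨ cong (2 ℕ.^_) (exponents (2 ℕ.^ toℕ j) (ℕ.^-monoʳ-≤ 2 (Fin.toℕ<n j))) ⟩
        2 ℕ.^ (M ℕ.+ (M ∸ 2 ℕ.^ suc (toℕ j)))
          ≡⟨ ℕ.^-distribˡ-+-* 2 M _ ⟩
        N ℕ.* Z  ∎

    xₙ≡1 : eval ρ xₙ ≡ fromℤ 1ℤ
    xₙ≡1 = trans (eval-var ρ (fromℕ (2 ℕ.+ m))) (cong (λ e → fromℤ (ℤ.+ (2 ℕ.^ e)))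
      (trans (cong (λ k → M ∸ 2 ℕ.^ k) (Fin.toℕ-fromℕ m)) (ℕ.n∸n≡0 M)))

  H-vanishes : eval nearRoot (H (2 ℕ.+ m) (s≤s (s≤s z≤n))) ≡ fromℤ 0ℤ
  H-vanishes = trans
    (eval-quartic ρ {con (ℤ.+ 4)} {con (ℤ.+ 2)} {x₁ - t} {x₁ - con (ℤ.+ 2) * x₂} {c = link} {xₙ}
      (eval-con ρ (ℤ.+ 4)) (eval-con ρ (ℤ.+ 2)) x₁-t x₁-2x₂ link-vanishes xₙ≡1)
    -- Closed arithmetic in ℤ[i]: i⁴ + i⁴ + 0 + 4 · i² · 1 + 2 · 1 = 1 + 1 - 4 + 2.
    refl

  H-lowerBound : Complexity> SubtractionFree (fromPoly (H (2 ℕ.+ m) (s≤s (s≤s z≤n)))) M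
  H-lowerBound c noSub comp = ℕ.≰⇒> λ s≤M → ℕ.<⇒≱
    (vanishing⇒large nearRoot nearRoot∈cone (re-power>0 N) H-vanishes c noSub comp)
    (ℕ.^-monoʳ-≤ 2 s≤M)

-- Formulas and their compilation to circuits

-- The index is the exact uncancelled rational function, so the compiled gates satisfy `Values` on
-- the nose, and `≃` enters only at the output. Trees repeat shared subterms, which is affordable
-- because Hₙ written out as an expression is of linear size.
data Formula {n : ℕ} (K : Op → Set) : RatFun n → Set where
  input  : ∀ i → Formula K (fromPoly (var i))
  scalar : ∀ c .{{_ : ℕ.NonZero c}} → Formula K (fromPoly (con (ℤ.+ c)))
  node   : ∀ {op f g h} → K op → Formula K f → Formula K g → Apply op f g h → Formula K h

operations : ∀ {n K} {f : RatFun n} → Formula K f → ℕ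
operations (input i)      = 0
operations (scalar c)     = 0
operations (node _ φ ψ _) = suc (operations φ ℕ.+ operations ψ)

weaken : ∀ {n s} → Source n s → Source n (suc s)
weaken (input i)  = input i
weaken (scalar c) = scalar c
weaken (gate j)   = gate (suc j)

value-weaken : ∀ {n s} v (vs : Vec (RatFun n) s) a → value (v ∷ vs) (weaken a) ≡ value vs a
value-weaken v vs (input i)  = refl
value-weaken v vs (scalar c) = refl
value-weaken v vs (gate j)   = refl

module Compile {n : ℕ} (K : Op → Set) (P : ∀ {s} → Gates n s → Set)
  (P▷ : ∀ {s} {gs : Gates n s} {op a b} → P gs → K op → P (gs ▷⟨ op , a , b ⟩)) where

  -- `lift` follows earlier wires through the added gates, so that the output of a left operand can
  -- still be read after the right operand has been compiled.
  record Extension {s} (vs : Vec (RatFun n) s) (f : RatFun n) (k : ℕ) : Set where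
    field
      {size′}    : ℕ
      size≡      : size′ ≡ k ℕ.+ s
      gates′     : Gates n size′
      {values′}  : Vec (RatFun n) size′
      isValues   : Values gates′ values′
      admissible : P gates′
      output′    : Source n size′
      output≡    : value values′ output′ ≡ f
      lift       : Source n s → Source n size′
      lift≡      : ∀ a → value values′ (lift a) ≡ value vs a

  compile : ∀ {s f} {gs : Gates n s} {vs} → Values gs vs → P gs →
            (φ : Formula K f) → Extension vs f (operations φ)
  compile {gs = gs} vals Pgs (input i) = record
    { size≡ = refl ; gates′ = gs ; isValues = vals ; admissible = Pgs
    ; output′ = input i ; output≡ = refl ; lift = λ a → a ; lift≡ = λ a → refl }
  compile {gs = gs} vals Pgs (scalar c) = record
    { size≡ = refl ; gates′ = gs ; isValues = vals ; admissible = Pgs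
    ; output′ = scalar c ; output≡ = refl ; lift = λ a → a ; lift≡ = λ a → refl }
  compile {s} {h} vals Pgs (node {op} {f} {g} Kop φ ψ app) = record
    { size≡      = cong suc (trans Ψ.size≡ (trans (cong (operations ψ ℕ.+_) Φ.size≡)
        (trans (sym (ℕ.+-assoc (operations ψ) (operations φ) s))
               (cong (ℕ._+ s) (ℕ.+-comm (operations ψ) (operations φ))))))
    ; gates′     = Ψ.gates′ ▷⟨ op , Ψ.lift Φ.output′ , Ψ.output′ ⟩
    ; isValues   = Ψ.isValues ▷
        subst₂ (λ f g → Apply op f g h)
          (sym (trans (Ψ.lift≡ Φ.output′) Φ.output≡)) (sym Ψ.output≡) app
    ; admissible = P▷ Ψ.admissible Kop
    ; output′    = gate zero
    ; output≡    = refl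
    ; lift       = λ a → weaken (Ψ.lift (Φ.lift a))
    ; lift≡      = λ a → trans (value-weaken h Ψ.values′ (Ψ.lift (Φ.lift a)))
                           (trans (Ψ.lift≡ (Φ.lift a)) (Φ.lift≡ a))
    }
    where
    module Φ = Extension (compile vals Pgs φ)
    module Ψ = Extension (compile Φ.isValues Φ.admissible ψ)

  circuit : ∀ {f g} → P [] → (φ : Formula K f) → f ≃ g →
            ∃[ c ] P (gates c) × Computes c g × size c ≡ operations φ
  circuit {g = g} P[] φ f≃g =
    record { size = size′ ; gates = gates′ ; output = output′ } ,
    admissible , (values′ , isValues , subst (_≃ g) (sym output≡) f≃g) ,
    trans size≡ (ℕ.+-identityʳ (operations φ))
    where open Extension (compile [] P[] φ)

*-≈1ʳ : ∀ {n} {p p′ q : Poly n} → p ≈ p′ → q ≈ 1# → p * q ≈ p′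
*-≈1ʳ {p′ = p′} p≈p′ q≈1 = ≈-trans (*-cong p≈p′ q≈1) (*-identityʳ p′)

-- The operations build up denominators that are products of copies of `1#`, hence the weaker
-- requirement `den≈`.
record PolyFormula {n : ℕ} (K : Op → Set) (p : Poly n) : Set where
  field
    {ratFun} : RatFun n
    formula  : Formula K ratFun
    num≈     : num ratFun ≈ p
    den≈     : den ratFun ≈ 1#

open PolyFormula

module _ {n : ℕ} {K : Op → Set} where

  formula-resp : ∀ {p q : Poly n} → p ≈ q → PolyFormula K p → PolyFormula K q
  formula-resp p≈q φ = record
    { formula = formula φ ; num≈ = ≈-trans (num≈ φ) p≈q ; den≈ = den≈ φ }

  formula-var : ∀ i → PolyFormula K (var {n} i)
  formula-var i = record { formula = input i ; num≈ = ≈-refl ; den≈ = ≈-refl }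

  formula-con : ∀ c .{{_ : ℕ.NonZero c}} → PolyFormula K (con {n} (ℤ.+ c))
  formula-con c = record { formula = scalar c ; num≈ = ≈-refl ; den≈ = ≈-refl }

  formula-+ : K add → ∀ {p q : Poly n} → PolyFormula K p → PolyFormula K q → PolyFormula K (p + q)
  formula-+ Kadd φ ψ = record
    { formula = node Kadd (formula φ) (formula ψ) add
    ; num≈    = +-cong (*-≈1ʳ (num≈ φ) (den≈ ψ)) (*-≈1ʳ (num≈ ψ) (den≈ φ))
    ; den≈    = *-≈1ʳ (den≈ φ) (den≈ ψ)
    }

  formula-- : K sub → ∀ {p q : Poly n} → PolyFormula K p → PolyFormula K q → PolyFormula K (p - q)
  formula-- Ksub φ ψ = record
    { formula = node Ksub (formula φ) (formula ψ) sub
    ; num≈    = +-cong (*-≈1ʳ (num≈ φ) (den≈ ψ)) (-‿cong (*-≈1ʳ (num≈ ψ) (den≈ φ)))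
    ; den≈    = *-≈1ʳ (den≈ φ) (den≈ ψ)
    }

  formula-* : K mul → ∀ {p q : Poly n} → PolyFormula K p → PolyFormula K q → PolyFormula K (p * q)
  formula-* Kmul φ ψ = record
    { formula = node Kmul (formula φ) (formula ψ) mul
    ; num≈    = *-cong (num≈ φ) (num≈ ψ)
    ; den≈    = *-≈1ʳ (den≈ φ) (den≈ ψ)
    }

-- Positive polynomials and finiteness

-- Positivity is a derivation rather than a condition on coefficients, because a derivation already
-- is a subtraction-free formula.
data Positive {n : ℕ} : Poly n → Set where
  var⁺ : ∀ i → Positive (var i)
  con⁺ : ∀ k → Positive (con (ℤ.+ suc k))
  _+⁺_ : ∀ {p q} → Positive p → Positive q → Positive (p + q)
  _*⁺_ : ∀ {p q} → Positive p → Positive q → Positive (p * q)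

positive-formula : ∀ {n} {p : Poly n} → Positive p → PolyFormula (λ op → ¬ op ≡ sub) p
positive-formula (var⁺ i)  = formula-var i
positive-formula (con⁺ k)  = formula-con (suc k)
positive-formula (p⁺ +⁺ q⁺) = formula-+ (λ ()) (positive-formula p⁺) (positive-formula q⁺)
positive-formula (p⁺ *⁺ q⁺) = formula-* (λ ()) (positive-formula p⁺) (positive-formula q⁺)

-- At the point with all coordinates 1 the value is a positive integer; the cone for w = 1 and
-- degree 0 expresses exactly this.
positive⇒≉0# : ∀ {n} {p : Poly n} → Positive p → p ≉ 0#
positive⇒≉0# {n} p⁺ p≈0 = ℤ.<-irrefl (sym (cong ℤ[i].re (trans (eval-cong ρ p≈0) (eval-0# ρ))))
  (cone⇒re>0 (λ { z≤n → ℤ.+<+ (s≤s z≤n) }) (positive∈cone p⁺))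
  where
  ρ : Fin n → ℤ[i]
  ρ _ = fromℤ 1ℤ

  positive∈cone : ∀ {p} → Positive p → Cone (fromℤ 1ℤ) 0 (eval ρ p)
  positive∈cone (var⁺ i) = subst (Cone _ 0) (sym (eval-var ρ i)) (power z≤n)
  positive∈cone (con⁺ k) = cone-eval-con ρ (suc k)
  positive∈cone (_+⁺_ {p} {q} p⁺ q⁺) =
    cone-eval-+ ρ p q (positive∈cone p⁺) (positive∈cone q⁺)
  positive∈cone (_*⁺_ {p} {q} p⁺ q⁺) =
    cone-eval-* ρ p q (positive∈cone p⁺) (positive∈cone q⁺)

positiveCone : ∀ n → PositiveCone (polyRing n) con-morphism
positiveCone n = record { Positive = Positive ; con⁺ = con⁺ ; _+⁺_ = _+⁺_ ; _*⁺_ = _*⁺_ }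

module Ratios (n : ℕ) = PositiveRatios {polyRing n} {con-morphism} (positiveCone n)

-- The circuit evaluates dividend and divisor as polynomials and ends with its only division.
ratio⇒finite : ∀ {n} {p : Poly n} → Ratios.Ratio⁺ n p → FiniteComplexity SubtractionFree (fromPoly p)
ratio⇒finite {n} {p} (PositiveRatios.ratio {a} {b} a⁺ b⁺ ap≈b) =
  let c , noSub , computes , _ = circuit [] quotient quotient≃ in c , noSub , computes
  where
  open Compile (λ op → ¬ op ≡ sub) NoSub _▷_
  φ = positive-formula a⁺
  ψ = positive-formula b⁺
  quotient = node (λ ()) (formula ψ) (formula φ)
    (div (λ num≈0 → positive⇒≉0# a⁺ (≈-trans (≈-sym (num≈ φ)) num≈0)))
  open SetoidReasoning (polySetoid n)
  quotient≃ = mk≃ (begin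
    (num (ratFun ψ) * den (ratFun φ)) * 1#
      ≈⟨ *-≈1ʳ (*-≈1ʳ (num≈ ψ) (den≈ φ)) ≈-refl ⟩
    b                                       ≈⟨ ap≈b ⟨
    a * p                                   ≈⟨ *-comm a p ⟩
    p * a                                   ≈⟨ *-congˡ p (*-identityˡ a) ⟨
    p * (1# * a)                            ≈⟨ *-congˡ p (*-cong (den≈ ψ) (num≈ φ)) ⟨
    p * (den (ratFun ψ) * num (ratFun φ))   ∎)

H-finite : ∀ m → FiniteComplexity SubtractionFree (fromPoly (H (2 ℕ.+ m) (s≤s (s≤s z≤n))))
H-finite m = ratio⇒finite (ratio-quartic (λ j → var (suc (suc j)))
  (ratio-positive (var⁺ zero)) (ratio-positive (var⁺ (suc zero))) (λ j → ratio-positive (var⁺ (suc (suc j)))))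
  where open Ratios (3 ℕ.+ m)

-- Ordinary circuits of linear size

module _ {n : ℕ} where
  open RawSemiringDefinitions (RawRing.rawSemiring (polyRawRing n)) using (sum)
    renaming (_^_ to _^ᴾ_)
  open Quartic (polyRawRing n) using (quartic)

  private
    PF : Poly n → Set
    PF = PolyFormula (λ _ → ⊤)

    ops : ∀ {p} → PF p → ℕ
    ops φ = operations (formula φ)

  formula-^ : ∀ {p} → PF p → ∀ k → PF (p ^ᴾ k)
  formula-^ φ zero    = formula-con 1
  formula-^ φ (suc k) = formula-* tt φ (formula-^ φ k)

  formula-sum : ∀ {m} {f : Fin m → Poly n} → (∀ j → PF (f j)) → PF (sum f)
  formula-sum {zero}  φ =
    -- Circuit scalars are positive, so the 0 that ends the sum is made by a gate as 1 - 1; this is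
    -- the leading `suc` in `operations-sum`.
    formula-resp (-‿inverseʳ 1#) (formula-- tt (formula-con 1) (formula-con 1))
  formula-sum {suc m} φ = formula-+ tt (φ zero) (formula-sum (λ j → φ (suc j)))

  operations-sum : ∀ {m} {f : Fin m → Poly n} (φ : ∀ j → PF (f j)) {k} →
                   (∀ j → ops (φ j) ≡ k) → ops (formula-sum φ) ≡ suc (m ℕ.* suc k)
  operations-sum {zero}  φ {k} eq = refl
  operations-sum {suc m} φ {k} eq = cong suc
    (trans (cong₂ ℕ._+_ (eq zero) (operations-sum (λ j → φ (suc j)) (λ j → eq (suc j))))
           (ℕ.+-suc k (m ℕ.* suc k)))

  formula-quartic : ∀ {a b x : Poly n} {m} {c : Fin m → Poly n} →
    PF a → PF b → (∀ j → PF (c j)) → PF x → PF (quartic (con (ℤ.+ 4)) (con (ℤ.+ 2)) a b c x)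
  formula-quartic α β γ ξ =
    formula-+ tt (formula-+ tt (formula-+ tt (formula-+ tt
      (formula-^ α 4) (formula-^ β 4)) (formula-sum (λ j → formula-^ (γ j) 2)))
      (formula-* tt (formula-* tt (formula-con 4) (formula-^ α 2)) (formula-^ ξ 2)))
      (formula-* tt (formula-con 2) (formula-^ ξ 4))

H-linear : ∀ m → Complexity≤ Ordinary (fromPoly (H (2 ℕ.+ m) (s≤s (s≤s z≤n)))) (19 ℕ.* (2 ℕ.+ m))
H-linear m =
  let c , _ , computes , size≡ = circuit tt (formula φ) φ≃H
  in c , tt , computes , ℕ.≤-trans (ℕ.≤-reflexive (trans size≡ operations-φ)) bound
  where
  open Compile (λ _ → ⊤) (λ _ → ⊤) (λ _ _ → tt)
  v : ∀ i → PolyFormula (λ _ → ⊤) (var {3 ℕ.+ m} i)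
  v = formula-var
  link = λ (j : Fin m) → formula-- tt (formula-^ (v (suc (suc (inject₁ j)))) 2)
                              (formula-* tt (v zero) (v (suc (suc (suc j)))))
  φ = formula-quartic (formula-- tt (v (suc zero)) (v zero))
        (formula-- tt (v (suc zero)) (formula-* tt (formula-con 2) (v (suc (suc zero)))))
        link (v (fromℕ (2 ℕ.+ m)))
  φ≃H : ratFun φ ≃ fromPoly (H (2 ℕ.+ m) (s≤s (s≤s z≤n)))
  φ≃H = mk≃ (*-cong (num≈ φ) (≈-sym (den≈ φ)))
  S = operations (formula (formula-sum (λ j → formula-^ (link j) 2)))
  open ℕ-Solver.+-*-Solver using (solve; _:+_; _:*_; _:=_) renaming (con to :con)
  operations-φ : operations (formula φ) ≡ 38 ℕ.+ 11 ℕ.* m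
  operations-φ = trans
    (solve 1 (λ S → :con 1 :+ (:con 1 :+ (:con 1 :+ (:con 21 :+ S) :+ :con 8) :+ :con 5) :=
       S :+ :con 37) refl S)
    -- The 10 is one squared link: 4 operations for xᵢ² - t xᵢ₊₁, done twice, and 2 multiplications,
    -- since `p ^ 2` unfolds to `p * (p * 1#)`.
    (trans (cong (ℕ._+ 37) (operations-sum (λ j → formula-^ (link j) 2) {10} (λ j → refl)))
      (solve 1 (λ m → :con 1 :+ m :* :con 11 :+ :con 37 := :con 38 :+ :con 11 :* m) refl m))
  -- The constant 19 is fixed by n = 2, where 38 operations must be at most 2C; each further
  -- variable costs only 11.
  bound : 38 ℕ.+ 11 ℕ.* m ≤ 19 ℕ.* (2 ℕ.+ m)
  bound = ℕ.≤-trans (ℕ.+-monoʳ-≤ 38 (ℕ.*-monoˡ-≤ m (ℕ.m≤m+n 11 8)))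
    (ℕ.≤-reflexive (sym (ℕ.*-distribˡ-+ 19 2 m)))

open import Data.Nat.Base using (_^_)

proposition8p4 :
    ((n : ℕ) (n≥2 : 2 ≤ n) →
       FiniteComplexity SubtractionFree (fromPoly (H n n≥2)) ×
       Complexity> SubtractionFree (fromPoly (H n n≥2)) (2 ^ (n ∸ 2)))
    ×
    (∃[ C ] ((n : ℕ) (n≥2 : 2 ≤ n) →
       Complexity≤ Ordinary (fromPoly (H n n≥2)) (C ℕ.* n)))
proposition8p4 =
  (λ { (suc (suc m)) (s≤s (s≤s z≤n)) → H-finite m , H-lowerBound m }) ,
  19 , λ { (suc (suc m)) (s≤s (s≤s z≤n)) → H-linear m }
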